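{- Let $\vec G_1$ and $\vec G_2$ be any two realizations of the same directed degree sequence. Modify the definition of the weighted swap-distance so that, besides $C_4$-swaps (weight $1$), any circuit of length 6 (triangular or not) can be swapped in one step with weight $2$, and let $\mathbf{dist}'(\vec G_1,\vec G_2)$ be the resulting minimum total weight of a swap sequence transforming $\vec G_1$ into $\vec G_2$. Then $$\mathbf{dist}'(\vec G_1,\vec G_2)=H'(\vec G_1,\vec G_2)-\mathbf{maxC}_d(\vec G_1,\vec G_2),$$ and there exists a shortest (minimum total weight) swap sequence from $\vec G_1$ to $\vec G_2$ which contains only $C_4$-swaps and triangular $C_6$-swaps.
   Context: Directed graphs are finite, without loops and without parallel edges (both $xy$ and $yx$ may be present), with labeled vertices $x_1,\dots,x_n$. The directed degree sequence of $\vec G$ is the pair of sequences of out-degrees and in-degrees of the vertices; $\vec G$ is then called a realization of this pair. Bipartite representation: $B(\vec G)$ has classes $U=\{u_x\}$ and $W=\{w_x\}$, one copy of each vertex $x$ in each class, and the directed edge $xy$ is represented by the edge $u_xw_y$. The pairs $u_xw_x$ are non-chords (they can never be edges); all other pairs $u_xw_y$ ($x\neq y$) are chords. Swaps: a $C_4$-swap takes distinct $u_x,u_z\in U$ and distinct $w_y,w_t\in W$ such that all four pairs between them are chords, with $u_xw_y,u_zw_t$ edges and $u_xw_t,u_zw_y$ non-edges, and replaces the edges $u_xw_y,u_zw_t$ by $u_xw_t,u_zw_y$. Swapping a circuit of length 6 means: taking a 6-cycle of chords on three distinct vertices of $U$ and three distinct vertices of $W$ whose pairs are alternately edges and non-edges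 of the current graph, and exchanging the edges with the non-edges along it. A triangular $C_6$-swap is such a 6-cycle swap in which the three opposite pairs of the 6-cycle are all non-chords; equivalently, an oriented triangle $xy,yz,zx$ (with $yx,zy,xz$ absent) is replaced by the oppositely oriented triangle $yx,zy,xz$. $H'(\vec G_1,\vec G_2)=|E(\vec G_1)\,\Delta\, E(\vec G_2)|/2$, where $\Delta$ is the symmetric difference of the sets of directed edges. The red-blue directed graph associated with $\vec G_1,\vec G_2$ has the common vertex set, directed edge set $E(\vec G_1)\,\Delta\, E(\vec G_2)$, edges of $E(\vec G_1)\setminus E(\vec G_2)$ red and edges of $E(\vec G_2)\setminus E(\vec G_1)$ blue. An alternating circuit in it is a closed trail (orientations ignored when traversing, each directed edge used at most once) along which, cyclically, both the colors and the directions alternate: consecutive edges have different colors and are either both directed into or both directed out of their common vertex in the trail. The edge set can always be decomposed into alternating circuits, and $\mathbf{maxC}_d(\vec G_1,\vec G_2)$ is the maximum number of circuits in such a decomposition. -}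

module Defs where

open import Data.Bool using (Bool; true; false; _xor_)
open import Data.Empty using (⊥)
open import Data.Fin using (Fin)
open import Data.Fin.Subset using (∣_∣)
open import Data.List using (List; []; _∷_; _∷ʳ_; _++_; map; concat; length; filterᵇ; allFin; cartesianProduct)
open import Data.List.Membership.Propositional using (_∉_)
open import Data.List.Relation.Binary.Permutation.Propositional using (_↭_)
open import Data.List.Relation.Unary.All using (All)
open import Data.List.Relation.Unary.Linked using (Linked)
open import Data.List.Relation.Unary.Unique.Propositional using (Unique)
open import Data.Nat using (ℕ; _+_; _≤_; _≥_; _/_)
open import Data.Product using (Σ-syntax; ∃-syntax; _×_; _,_; proj₁; proj₂)
open import Data.Sum using (_⊎_)
open import Data.Unit using (⊤)
open import Data.Vec using (tabulate)
open import Relation.Binary.PropositionalEquality using (_≡_; _≢_)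

-- A pair (x , y) is read both as the possible directed edge xy and as the
-- pair u_x w_y of the bipartite representation; the first component thus
-- always names a vertex of U and the second a vertex of W.
Pair : ℕ → Set
Pair n = Fin n × Fin n

Chord NonChord : ∀ {n} → Pair n → Set
Chord    (x , y) = x ≢ y
NonChord (x , y) = x ≡ y

record Digraph (n : ℕ) : Set where
  field
    edge     : Pair n → Bool
    loopless : ∀ x → edge (x , x) ≡ false

open Digraph public

Edge NonEdge : ∀ {n} → Digraph n → Pair n → Set
Edge    G e = edge G e ≡ true
NonEdge G e = edge G e ≡ false

-- Equality of labeled digraphs (pointwise, as edge sets are functions).
infix 4 _≐_
_≐_ : ∀ {n} → Digraph n → Digraph n → Set
G ≐ H = ∀ e → edge G e ≡ edge H e

outDegree inDegree : ∀ {n} → Digraph n → Fin n → ℕ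
outDegree G x = ∣ tabulate (λ y → edge G (x , y)) ∣
inDegree  G x = ∣ tabulate (λ y → edge G (y , x)) ∣

Realizes : ∀ {n} → Digraph n → (d⁺ d⁻ : Fin n → ℕ) → Set
Realizes G d⁺ d⁻ = ∀ x → outDegree G x ≡ d⁺ x × inDegree G x ≡ d⁻ x

-- G′ arises from G by exchanging the edges es with the non-edges ns.
record Exchange {n} (G : Digraph n) (es ns : List (Pair n)) (G′ : Digraph n) : Set where
  field
    chords      : All Chord (es ++ ns)
    es-edges    : All (Edge G) es
    ns-nonEdges : All (NonEdge G) ns
    es-removed  : All (NonEdge G′) es
    ns-added    : All (Edge G′) ns
    elsewhere   : ∀ e → e ∉ es ++ ns → edge G′ e ≡ edge G e

record C₄Swap {n} (G G′ : Digraph n) : Set where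
  field
    x z : Fin n
    y t : Fin n
    x≢z : x ≢ z
    y≢t : y ≢ t
    exchange : Exchange G ((x , y) ∷ (z , t) ∷ [])
                          ((x , t) ∷ (z , y) ∷ []) G′

-- The 6-cycle is u_x₁ w_y₁ u_x₂ w_y₂ u_x₃ w_y₃.
record C₆Swap {n} (G G′ : Digraph n) : Set where
  field
    x₁ x₂ x₃ : Fin n
    y₁ y₂ y₃ : Fin n
    distinctU : x₁ ≢ x₂ × x₂ ≢ x₃ × x₃ ≢ x₁
    distinctW : y₁ ≢ y₂ × y₂ ≢ y₃ × y₃ ≢ y₁
    exchange : Exchange G ((x₁ , y₁) ∷ (x₂ , y₂) ∷ (x₃ , y₃) ∷ [])
                          ((x₂ , y₁) ∷ (x₃ , y₂) ∷ (x₁ , y₃) ∷ []) G′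

-- The pairs listed are the three opposite pairs of the 6-cycle.
Triangular : ∀ {n} {G G′ : Digraph n} → C₆Swap G G′ → Set
Triangular s = NonChord (x₁ , y₂) × NonChord (x₂ , y₃) × NonChord (x₃ , y₁)
  where open C₆Swap s

data Swap {n} (G G′ : Digraph n) : Set where
  c₄ : C₄Swap G G′ → Swap G G′
  c₆ : C₆Swap G G′ → Swap G G′

swapWeight : ∀ {n} {G G′ : Digraph n} → Swap G G′ → ℕ
swapWeight (c₄ _) = 1
swapWeight (c₆ _) = 2

infixr 5 _∷_
data SwapSequence {n} : Digraph n → Digraph n → Set where
  done : ∀ {G H} → G ≐ H → SwapSequence G H
  _∷_  : ∀ {G G′ H} → Swap G G′ → SwapSequence G′ H → SwapSequence G H

weight : ∀ {n} {G H : Digraph n} → SwapSequence G H → ℕ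
weight (done _) = 0
weight (s ∷ ss) = swapWeight s + weight ss

C₄OrTriangular : ∀ {n} {G G′ : Digraph n} → Swap G G′ → Set
C₄OrTriangular (c₄ _) = ⊤
C₄OrTriangular (c₆ s) = Triangular s

OnlyC₄AndTriangular : ∀ {n} {G H : Digraph n} → SwapSequence G H → Set
OnlyC₄AndTriangular (done _) = ⊤
OnlyC₄AndTriangular (s ∷ ss) = C₄OrTriangular s × OnlyC₄AndTriangular ss

IsMinimum IsMaximum : (ℕ → Set) → ℕ → Set
IsMinimum P k = P k × (∀ j → P j → k ≤ j)
IsMaximum P k = P k × (∀ j → P j → k ≥ j)

IsDist′ : ∀ {n} → Digraph n → Digraph n → ℕ → Set
IsDist′ G₁ G₂ = IsMinimum (λ w → Σ[ ss ∈ SwapSequence G₁ G₂ ] weight ss ≡ w)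

-- The edges of the red-blue digraph, each listed once.
symmetricDifference : ∀ {n} → Digraph n → Digraph n → List (Pair n)
symmetricDifference {n} G₁ G₂ =
  filterᵇ (λ e → edge G₁ e xor edge G₂ e) (cartesianProduct (allFin n) (allFin n))

-- For two realizations of the same degree sequence the division is exact,
-- since G₁ and G₂ then have equally many edges.
H′ : ∀ {n} → Digraph n → Digraph n → ℕ
H′ G₁ G₂ = length (symmetricDifference G₁ G₂) / 2

-- One step of a trail that ignores orientations: a directed edge together
-- with the direction in which it is traversed.
data Step (n : ℕ) : Set where
  along against : Pair n → Step n

arc : ∀ {n} → Step n → Pair n
arc (along   e) = e
arc (against e) = e

from to : ∀ {n} → Step n → Fin n
from (along   (x , y)) = x
from (against (x , y)) = y
to   (along   (x , y)) = y
to   (against (x , y)) = x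

module _ {n} (G₁ G₂ : Digraph n) where

  Red Blue : Pair n → Set
  Red  e = Edge G₁ e × NonEdge G₂ e
  Blue e = Edge G₂ e × NonEdge G₁ e

  DifferentColors : Pair n → Pair n → Set
  DifferentColors e f = (Red e × Blue f) ⊎ (Blue e × Red f)

  BothInto BothOutOf : Fin n → Pair n → Pair n → Set
  BothInto  v e f = proj₂ e ≡ v × proj₂ f ≡ v
  BothOutOf v e f = proj₁ e ≡ v × proj₁ f ≡ v

  record Alternates (s s′ : Step n) : Set where
    field
      consecutive : to s ≡ from s′
      colors      : DifferentColors (arc s) (arc s′)
      directions  : BothInto (to s) (arc s) (arc s′) ⊎ BothOutOf (to s) (arc s) (arc s′)

  -- The first step is repeated at the end to express the cyclic condition.
  -- All edges lie in the red-blue digraph because they are colored.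
  AlternatingCircuit : List (Step n) → Set
  AlternatingCircuit []       = ⊥
  AlternatingCircuit (s ∷ ss) =
    Unique (map arc (s ∷ ss)) × Linked Alternates (s ∷ (ss ∷ʳ s))

  IsDecomposition : List (List (Step n)) → Set
  IsDecomposition cs =
    All AlternatingCircuit cs × map arc (concat cs) ↭ symmetricDifference G₁ G₂

  IsMaxC : ℕ → Set
  IsMaxC = IsMaximum (λ k → ∃[ cs ] (IsDecomposition cs × length cs ≡ k))

{-# OPTIONS --safe #-}
-- Encode a closed alternating walk by its red arcs and give a walk of length 2ℓ
-- the value ℓ − 1.  A swap sequence of weight w is then a collection of walks of
-- total value w whose signed sum of arcs telescopes to E(G₁) − E(G₂).  Arcs that
-- occur both red and blue can be cancelled, merging or splitting walks, without
-- increasing the value; what remains is a decomposition of the red-blue digraph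
-- into alternating circuits, whose value is H′ minus the number of circuits.
-- Conversely, let a decomposition of total value v be given.  Two or more circuits
-- are treated one after the other, through the digraph that differs from G₁ by the
-- first.  A single circuit is cut in two along a chord from its first vertex (the
-- side whose exchange is legal goes first), or is split at a repeated vertex, until
-- only C₄-swaps and triangular C₆-swaps remain; their total weight is at most v.
module Submission where

open import Defs
open import Data.Bool using (Bool; true; false; not; _∧_; _xor_; if_then_else_; T?)
open import Data.Bool.Properties using (∧-inverseʳ)
open import Data.Fin using (Fin; zero; suc)
import Data.Fin.Properties as Fin
open import Data.Fin.Subset using (∣_∣)
import Data.Integer.Properties as ℤ
open import Data.List
  using (List; []; _∷_; _∷ʳ_; _++_; map; concat; length; filter; filterᵇ; reverse; replicate; tabulate;
         allFin; cartesianProduct; cartesianProductWith; initLast; _∷ʳ′_)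
open import Data.List.Extrema.Nat using (argmin; argmin-all; f[argmin]≤f[xs])
open import Data.List.Membership.Propositional using (_∈_; _∉_; find)
open import Data.List.Membership.Propositional.Properties
  using (∈-∃++; ∈-++⁻; ∈-++⁺ˡ; ∈-++⁺ʳ; ∈-concat⁻′; ∈-concat⁺′; ∈-map⁻; ∈-map⁺; ∈-filter⁺; ∈-allFin;
         ∈-cartesianProduct⁺; ∈-cartesianProductWith⁺)
open import Data.List.Properties
  using (++-assoc; ++-identityʳ; length-++; length-map; unfold-reverse; reverse-++; filter-++;
         map-++; map-∘; map-cong; map-id; concat-++; ∷-injective; ∷ʳ-injectiveˡ; ∷ʳ-injectiveʳ)
import Data.List.Relation.Binary.Permutation.Propositional as Perm
open import Data.List.Relation.Binary.Permutation.Propositional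
  using (_↭_; ↭-refl; ↭-sym; ↭-trans; ↭-reflexive; prep)
open import Data.List.Relation.Binary.Permutation.Propositional.Properties
  using (++-comm; ++⁺; ++⁺ˡ; ++⁺ʳ; shift; shifts; map⁺; ∷↭∷ʳ; ↭-reverse; ↭-length; ∈-resp-↭; All-resp-↭)
open import Data.List.Relation.Unary.All as All using (All; []; _∷_)
import Data.List.Relation.Unary.All.Properties as All
open import Data.List.Relation.Unary.AllPairs using ([]; _∷_)
open import Data.List.Relation.Unary.Any as Any using (here; there)
open import Data.List.Relation.Unary.Linked as Linked using (Linked; [-]; _∷_)
open import Data.List.Relation.Unary.Unique.Propositional using (Unique)
open import Data.List.Relation.Unary.Unique.Propositional.Properties using (cartesianProduct⁺; allFin⁺)
open import Data.Nat using (ℕ; zero; suc; _+_; _*_; _∸_; _/_; _≤_; _<_; z≤n; s≤s)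
open import Data.Nat.DivMod using (m*n/n≡m)
open import Data.Nat.ListAction using (sum)
open import Data.Nat.ListAction.Properties using (sum-++; sum-↭)
open import Data.Nat.Properties
open import Data.Nat.Solver using (module +-*-Solver)
open import Data.Product using (Σ-syntax; ∃-syntax; _×_; _,_; proj₁; proj₂)
import Data.Product.Properties as Product
open import Data.Sum as Sum using (_⊎_; inj₁; inj₂)
import Data.Vec as Vec
open import Function using (_∘_; id)
open import Relation.Binary.Definitions using (DecidableEquality)
open import Relation.Binary.PropositionalEquality
  using (_≡_; _≢_; refl; sym; trans; cong; cong₂; subst; module ≡-Reasoning)
open import Relation.Nullary using (¬_; Dec; yes; no; does; contradiction)
import Relation.Nullary.Decidable as Dec
open import Relation.Nullary.Decidable using (_×-dec_)

-- The value of a collection of nonempty walks is its number of red arcs minus its number of walks.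
-- It equals the swap weight for ℓ = 2 and ℓ = 3. Cutting along a chord adds one red arc and one
-- walk, and merging two walks along an arc of opposite colours loses one of each, so both preserve
-- the value; splitting at a repeated vertex lowers it. The same bookkeeping therefore serves the
-- lower bound and the construction. The obstacle is that swaps may use pairs outside the red-blue
-- digraph, so the walks describing a sequence can overlap and repeat arcs. Both halves are
-- therefore stated for arbitrary collections satisfying the signed identity `Balanced`, and
-- `reduce` restores a true decomposition whenever one is needed, in particular after each cut.
-- Since reducing may lower the value, the construction gives only an upper bound on the weight;
-- equality comes from minimality at the end. Equal degrees serve to produce one balanced
-- collection; a finite search then finds the least value.

⟦_⟧ : Bool → ℕ
⟦ true ⟧  = 1
⟦ false ⟧ = 0

-- Multiplicities in lists

module Counting {A : Set} (_≟_ : DecidableEquality A) where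

  open import Data.List.Membership.DecPropositional _≟_ public using (_∈?_)

  count : A → List A → ℕ
  count a []       = 0
  count a (x ∷ xs) = ⟦ does (a ≟ x) ⟧ + count a xs

  count-++ : ∀ a xs ys → count a (xs ++ ys) ≡ count a xs + count a ys
  count-++ a []       ys = refl
  count-++ a (x ∷ xs) ys rewrite count-++ a xs ys =
    sym (+-assoc ⟦ does (a ≟ x) ⟧ (count a xs) (count a ys))

  count-here : ∀ a xs → count a (a ∷ xs) ≡ suc (count a xs)
  count-here a xs with a ≟ a
  ... | yes _  = refl
  ... | no a≢a = contradiction refl a≢a

  count-there : ∀ {a x} xs → a ≢ x → count a (x ∷ xs) ≡ count a xs
  count-there {a} {x} xs a≢x with a ≟ x
  ... | yes a≡x = contradiction a≡x a≢x
  ... | no _    = refl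

  count-resp-↭ : ∀ {xs ys} a → xs ↭ ys → count a xs ≡ count a ys
  count-resp-↭ a Perm.refl         = refl
  count-resp-↭ a (Perm.prep x p)   = cong (⟦ does (a ≟ x) ⟧ +_) (count-resp-↭ a p)
  count-resp-↭ a (Perm.swap {xs} {ys} x y p) rewrite count-resp-↭ a p =
    trans (sym (+-assoc dx dy c)) (trans (cong (_+ c) (+-comm dx dy)) (+-assoc dy dx c))
    where dx = ⟦ does (a ≟ x) ⟧
          dy = ⟦ does (a ≟ y) ⟧
          c  = count a ys
  count-resp-↭ a (Perm.trans p q)  = trans (count-resp-↭ a p) (count-resp-↭ a q)

  ∈⇒count>0 : ∀ {a xs} → a ∈ xs → 1 ≤ count a xs
  ∈⇒count>0 {a} {_ ∷ xs} (here refl) = subst (1 ≤_) (sym (count-here a xs)) (s≤s z≤n)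
  ∈⇒count>0 {a} {x ∷ xs} (there a∈xs) = ≤-trans (∈⇒count>0 a∈xs) (m≤n+m _ _)

  count>0⇒∈ : ∀ {a} xs → 1 ≤ count a xs → a ∈ xs
  count>0⇒∈ {a} (x ∷ xs) h with a ≟ x
  ... | yes a≡x = here a≡x
  ... | no _    = there (count>0⇒∈ xs h)

  ∉⇒count≡0 : ∀ {a} xs → a ∉ xs → count a xs ≡ 0
  ∉⇒count≡0 {a} xs a∉xs with count a xs in eq
  ... | zero  = refl
  ... | suc k = contradiction (count>0⇒∈ xs (subst (1 ≤_) (sym eq) (s≤s z≤n))) a∉xs

  Unique⇒count≡1 : ∀ {a xs} → Unique xs → a ∈ xs → count a xs ≡ 1
  Unique⇒count≡1 {a} {_ ∷ xs} (x∉ ∷ _) (here refl) =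
    trans (count-here a xs) (cong suc (∉⇒count≡0 xs λ a∈xs → All.lookup x∉ a∈xs refl))
  Unique⇒count≡1 {a} {x ∷ xs} (x∉ ∷ u) (there a∈xs) =
    trans (count-there xs (λ a≡x → All.lookup x∉ a∈xs (sym a≡x))) (Unique⇒count≡1 u a∈xs)

  Unique⇒count≤1 : ∀ {xs} → Unique xs → ∀ a → count a xs ≤ 1
  Unique⇒count≤1 {xs} u a with a ∈? xs
  ... | yes a∈xs = ≤-reflexive (Unique⇒count≡1 u a∈xs)
  ... | no a∉xs  = subst (_≤ 1) (sym (∉⇒count≡0 xs a∉xs)) z≤n

  count≤1⇒Unique : ∀ xs → (∀ a → count a xs ≤ 1) → Unique xs
  count≤1⇒Unique []       h = []
  count≤1⇒Unique (x ∷ xs) h =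
    All.tabulate (λ {y} y∈xs x≡y → contradiction
      (≤-trans (s≤s (∈⇒count>0 (subst (_∈ xs) (sym x≡y) y∈xs))) (subst (_≤ 1) (count-here x xs) (h x)))
      λ { (s≤s ()) })
    ∷ count≤1⇒Unique xs (λ a → ≤-trans (m≤n+m _ _) (h a))

  count⇒↭ : ∀ xs ys → (∀ a → count a xs ≡ count a ys) → xs ↭ ys
  count⇒↭ []       []       h = ↭-refl
  count⇒↭ []       (y ∷ ys) h = contradiction (trans (h y) (count-here y ys)) λ ()
  count⇒↭ (x ∷ xs) ys       h
    with ∈-∃++ (count>0⇒∈ ys (subst (1 ≤_) (trans (sym (count-here x xs)) (h x)) (s≤s z≤n)))
  ... | ps , qs , refl = ↭-trans (prep x (count⇒↭ xs (ps ++ qs) h′)) (↭-sym (shift x ps qs))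
    where h′ : ∀ a → count a xs ≡ count a (ps ++ qs)
          h′ a = +-cancelˡ-≡ ⟦ does (a ≟ x) ⟧ _ _ (trans (h a) (count-resp-↭ a (shift x ps qs)))

_≟ₚ_ : ∀ {n} → DecidableEquality (Pair n)
_≟ₚ_ = Product.≡-dec Fin._≟_ Fin._≟_

open module PairCounting {n} = Counting (_≟ₚ_ {n}) public

-- Closed alternating walks and their blue arcs

-- A closed alternating walk u_x₁ w_y₁ u_x₂ w_y₂ … is encoded by the list of
-- its red arcs (x₁ , y₁), (x₂ , y₂), …; its blue arcs are (x₂ , y₁), (x₃ , y₂), ….
Walk : ℕ → Set
Walk n = List (Pair n)

next : ∀ {n} → Walk n → Fin n → Fin n
next []            z = z
next ((x , _) ∷ _) z = x

-- The vertex `z` is the end of an open walk, reached by the last blue arc. Taking `z` to be the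
-- first vertex closes the walk, but only the open form behaves well under concatenation.
bluesTo : ∀ {n} → Walk n → Fin n → List (Pair n)
bluesTo []            z = []
bluesTo ((x , y) ∷ w) z = (next w z , y) ∷ bluesTo w z

blues : ∀ {n} → Walk n → List (Pair n)
blues []                = []
blues w@((x , _) ∷ _) = bluesTo w x

private
  variable
    n : ℕ

next-++ : ∀ (p q : Walk n) z → next (p ++ q) z ≡ next p (next q z)
next-++ []      q z = refl
next-++ (_ ∷ _) q z = refl

bluesTo-++ : ∀ (p q : Walk n) z → bluesTo (p ++ q) z ≡ bluesTo p (next q z) ++ bluesTo q z
bluesTo-++ []            q z = refl
bluesTo-++ ((x , y) ∷ p) q z = cong₂ _∷_ (cong (_, y) (next-++ p q z)) (bluesTo-++ p q z)

bluesTo-∷ʳ : ∀ (p : Walk n) u y z → bluesTo (p ∷ʳ (u , y)) z ≡ bluesTo p u ∷ʳ (z , y)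
bluesTo-∷ʳ p u y z = bluesTo-++ p ((u , y) ∷ []) z

blues-∷ʳ : ∀ (p : Walk n) u y → blues (p ∷ʳ (u , y)) ≡ bluesTo p u ∷ʳ (next p u , y)
blues-∷ʳ []              u y = refl
blues-∷ʳ p@((x , _) ∷ _) u y = bluesTo-∷ʳ p u y x

length-bluesTo : ∀ (w : Walk n) z → length (bluesTo w z) ≡ length w
length-bluesTo []      z = refl
length-bluesTo (_ ∷ w) z = cong suc (length-bluesTo w z)

length-blues : ∀ (w : Walk n) → length (blues w) ≡ length w
length-blues []              = refl
length-blues w@((x , _) ∷ _) = length-bluesTo w x

∈-bluesTo⁻ : ∀ {x y : Fin n} w {z} → (x , y) ∈ bluesTo w z →
  (∃[ p ] ∃[ u ] ∃[ v ] ∃[ q ] w ≡ p ++ (u , y) ∷ (x , v) ∷ q)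
  ⊎ (∃[ p ] ∃[ u ] (w ≡ p ∷ʳ (u , y) × x ≡ z))
∈-bluesTo⁻ ((u , y) ∷ [])            (here refl) = inj₂ ([] , u , refl , refl)
∈-bluesTo⁻ ((u , y) ∷ (x , v) ∷ q)   (here refl) = inj₁ ([] , u , v , q , refl)
∈-bluesTo⁻ (a ∷ w)                   (there e∈)  with ∈-bluesTo⁻ w e∈
... | inj₁ (p , u , v , q , refl) = inj₁ (a ∷ p , u , v , q , refl)
... | inj₂ (p , u , refl , eq)    = inj₂ (a ∷ p , u , refl , eq)

blues-rotate : ∀ (p q : Walk n) → blues (p ++ q) ↭ blues (q ++ p)
blues-rotate []      q       = ↭-reflexive (cong blues (sym (++-identityʳ q)))
blues-rotate (a ∷ p) []      = ↭-reflexive (cong blues (++-identityʳ (a ∷ p)))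
blues-rotate p′@(a ∷ p) q′@(b ∷ q) = ↭-trans (↭-reflexive (bluesTo-++ p′ q′ (proj₁ a)))
  (↭-trans (++-comm (bluesTo p′ (proj₁ b)) (bluesTo q′ (proj₁ a)))
           (↭-reflexive (sym (bluesTo-++ q′ p′ (proj₁ b)))))

-- Both halves close at the repeated vertex `x` of U, where the whole walk passes from the first
-- half to the second, so even the order of the blue arcs is unchanged.
blues-splitˣ : ∀ {x y y′ : Fin n} p q →
  blues ((x , y) ∷ p ++ (x , y′) ∷ q) ≡ blues ((x , y) ∷ p) ++ blues ((x , y′) ∷ q)
blues-splitˣ {x = x} {y} {y′} p q = bluesTo-++ ((x , y) ∷ p) ((x , y′) ∷ q) x

-- Here the repeated vertex `y` lies in W. Each half ends with a red arc at `y`, and splitting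
-- interchanges the two blue arcs that follow these red arcs.
blues-splitʸ : ∀ (p q : Walk n) {u v y} →
  blues ((p ∷ʳ (u , y)) ++ (q ∷ʳ (v , y))) ↭ blues (p ∷ʳ (u , y)) ++ blues (q ∷ʳ (v , y))
blues-splitʸ p q {u} {v} {y} = ↭-trans (↭-reflexive unfolded)
  (↭-trans (count⇒↭ _ _ λ e → exchange-ends e)
           (↭-reflexive (sym (cong₂ _++_ (blues-∷ʳ p u y) (blues-∷ʳ q v y)))))
  where
  P = p ∷ʳ (u , y)
  A = bluesTo p u
  C = bluesTo q v
  b = (next p u , y)
  d = (next q v , y)
  unfolded : blues (P ++ (q ∷ʳ (v , y))) ≡ ((A ∷ʳ d) ++ C) ∷ʳ b
  unfolded = trans (cong blues (sym (++-assoc P q _)))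
    (trans (blues-∷ʳ (P ++ q) v y)
      (cong₂ (λ l x → l ∷ʳ (x , y))
        (trans (bluesTo-++ P q v) (cong (_++ C) (bluesTo-∷ʳ p u y (next q v))))
        (trans (next-++ P q v) (next-++ p _ _))))
  exchange-ends : ∀ e → count e (((A ∷ʳ d) ++ C) ∷ʳ b) ≡ count e ((A ∷ʳ b) ++ (C ∷ʳ d))
  exchange-ends e rewrite count-++ e ((A ∷ʳ d) ++ C) (b ∷ []) | count-++ e (A ∷ʳ d) C
    | count-++ e A (d ∷ []) | count-++ e (A ∷ʳ b) (C ∷ʳ d) | count-++ e A (b ∷ [])
    | count-++ e C (d ∷ []) =
    solve 4 (λ a b c d → (a :+ d) :+ c :+ b := (a :+ b) :+ (c :+ d)) refl
      (count e A) (count e (b ∷ [])) (count e C) (count e (d ∷ []))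
    where open +-*-Solver using (solve; _:+_; _:=_)

-- The closing blue arc is `(x , y)` itself, met immediately before its red copy. Deleting this
-- back-and-forth joins `y` directly to the next vertex of U.
blues-remove : ∀ {x y : Fin n} r {u} →
  blues ((x , y) ∷ r ∷ʳ (u , y)) ↭ (x , y) ∷ blues (r ∷ʳ (u , y))
blues-remove {x = x} {y} r {u} =
  ↭-trans (↭-reflexive (blues-∷ʳ ((x , y) ∷ r) u y))
  (↭-trans (↭-sym (∷↭∷ʳ (x , y) _))
  (prep (x , y) (↭-trans (∷↭∷ʳ (next r u , y) _) (↭-reflexive (sym (blues-∷ʳ r u y))))))

-- Any pair (x , y) joining the first vertex of P to its last one divides P ++ Q.
blues-chord : ∀ (p : Walk n) {u y} q →
  blues (p ∷ʳ (u , y)) ++ blues ((next p u , y) ∷ q)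
    ↭ (next p u , y) ∷ blues ((p ∷ʳ (u , y)) ++ q)
blues-chord p {u} {y} q =
  ↭-trans (++-comm (blues P) (blues (c ∷ q)))
  -- The two walks are concatenated at the first vertex of `P`, the one through `c` in front; then
  -- `c` is both the first red and the closing blue arc, and `blues-remove` deletes it.
  (↭-trans (↭-reflexive (sym (joined p)))
  (↭-trans (↭-reflexive (cong (blues ∘ (c ∷_)) (sym (++-assoc q p _))))
  (↭-trans (blues-remove (q ++ p))
  (prep c (↭-trans (↭-reflexive (cong blues (++-assoc q p _))) (blues-rotate q P))))))
  where
  P = p ∷ʳ (u , y)
  c = (next p u , y)
  joined : ∀ p → blues ((next p u , y) ∷ q ++ (p ∷ʳ (u , y)))
               ≡ blues ((next p u , y) ∷ q) ++ blues (p ∷ʳ (u , y))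
  joined []      = blues-splitˣ q []
  joined (_ ∷ p) = blues-splitˣ q (p ∷ʳ (u , y))

-- Read backwards, blue arcs serve as red ones and conversely. Since `bluesTo` forgets the first
-- vertex `x`, the first red arc comes back with `t` in its place.
bluesTo-reverse : ∀ (w : Walk n) x y z t →
  bluesTo (reverse (bluesTo ((x , y) ∷ w) z)) t ≡ reverse w ∷ʳ (t , y)
bluesTo-reverse []              x y z t = refl
bluesTo-reverse ((x′ , y′) ∷ w) x y z t =
  trans (cong (λ l → bluesTo l t) (unfold-reverse (x′ , y) (bluesTo ((x′ , y′) ∷ w) z)))
  (trans (bluesTo-∷ʳ (reverse (bluesTo ((x′ , y′) ∷ w) z)) x′ y t)
  (cong (_∷ʳ (t , y))
    (trans (bluesTo-reverse w x′ y′ z x′) (sym (unfold-reverse (x′ , y′) w)))))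

blues-reverse : ∀ (w : Walk n) → ∃[ w′ ] w′ ↭ blues w × blues w′ ↭ w
blues-reverse []              = [] , ↭-refl , ↭-refl
blues-reverse w@((x , y) ∷ t) = reverse (blues w) , ↭-reverse (blues w) ,
  ↭-trans (↭-reflexive (trans (closed w x) (bluesTo-reverse t x y x x)))
  (↭-trans (↭-sym (∷↭∷ʳ (x , y) (reverse t))) (prep (x , y) (↭-reverse t)))
  where
  closed : ∀ (w : Walk _) x → blues (reverse (bluesTo w x)) ≡ bluesTo (reverse (bluesTo w x)) x
  closed w x with initLast w
  ... | []           = refl
  ... | p ∷ʳ′ (u , v) rewrite bluesTo-∷ʳ p u v x | reverse-++ (bluesTo p u) ((x , v) ∷ []) = refl

-- Cancellation in collections of walks

blueArcs : List (Walk n) → List (Pair n)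
blueArcs cs = concat (map blues cs)

value : List (Walk n) → ℕ
value cs = sum (map (λ w → length w ∸ 1) cs)

concat-resp-↭ : ∀ {A : Set} {xss yss : List (List A)} → xss ↭ yss → concat xss ↭ concat yss
concat-resp-↭ Perm.refl             = ↭-refl
concat-resp-↭ (Perm.prep xs p)      = ++⁺ˡ xs (concat-resp-↭ p)
concat-resp-↭ (Perm.swap xs ys p)   = ↭-trans (shifts xs ys) (++⁺ˡ ys (++⁺ˡ xs (concat-resp-↭ p)))
concat-resp-↭ (Perm.trans p q)      = ↭-trans (concat-resp-↭ p) (concat-resp-↭ q)

blueArcs-++ : ∀ (cs ds : List (Walk n)) → blueArcs (cs ++ ds) ≡ blueArcs cs ++ blueArcs ds
blueArcs-++ cs ds = trans (cong concat (map-++ blues cs ds))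
  (sym (concat-++ (map blues cs) (map blues ds)))

value-++ : ∀ (cs ds : List (Walk n)) → value (cs ++ ds) ≡ value cs + value ds
value-++ cs ds = trans (cong sum (map-++ _ cs ds)) (sum-++ (map (λ w → length w ∸ 1) cs) _)

-- The arcs es are cancelled, each once as a red and once as a blue arc.
infix 4 _⟶[_]_
record _⟶[_]_ (cs : List (Walk n)) (es : List (Pair n)) (ds : List (Walk n)) : Set where
  constructor rewrites
  field
    reds-↭  : concat cs ↭ es ++ concat ds
    blues-↭ : blueArcs cs ↭ es ++ blueArcs ds
    value-≤ : value ds ≤ value cs

open _⟶[_]_ public

⟶-within : ∀ {cs ws ds rest : List (Walk n)} {es} →
  cs ↭ ws ++ rest → ws ⟶[ es ] ds → cs ⟶[ es ] ds ++ rest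
⟶-within {cs = cs} {ws} {ds} {rest} {es} p r = rewrites
  (↭-trans (concat-resp-↭ p) (↭-trans (↭-reflexive (sym (concat-++ ws rest)))
    (↭-trans (++⁺ʳ (concat rest) (reds-↭ r))
    (↭-reflexive (trans (++-assoc es (concat ds) (concat rest)) (cong (es ++_) (concat-++ ds rest)))))))
  (↭-trans (concat-resp-↭ (map⁺ blues p)) (↭-trans (↭-reflexive (blueArcs-++ ws rest))
    (↭-trans (++⁺ʳ (blueArcs rest) (blues-↭ r))
    (↭-reflexive (trans (++-assoc es (blueArcs ds) (blueArcs rest))
      (cong (es ++_) (sym (blueArcs-++ ds rest))))))))
  (begin
    value (ds ++ rest)       ≡⟨ value-++ ds rest ⟩
    value ds + value rest    ≤⟨ +-monoˡ-≤ (value rest) (value-≤ r) ⟩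
    value ws + value rest    ≡⟨ value-++ ws rest ⟨
    value (ws ++ rest)       ≡⟨ sum-↭ (map⁺ _ p) ⟨
    value cs                 ∎)
  where open ≤-Reasoning

Rotated : Walk n → Walk n → Set
Rotated w w′ = w ↭ w′ × blues w ↭ blues w′

rotate : ∀ (p q : Walk n) → Rotated (p ++ q) (q ++ p)
rotate p q = ++-comm p q , blues-rotate p q

starting-at : ∀ {e : Pair n} {w} → e ∈ w → ∃[ p ] Rotated w (e ∷ p)
starting-at e∈w with ∈-∃++ e∈w
... | ps , qs , refl = qs ++ ps , rotate ps (_ ∷ qs)

-- After rotation the blue arc closes the walk. The result is described from both ends: the first
-- arc is needed to join another walk at `x`, the last one to remove the arc afterwards.
around-blue : ∀ {x y : Fin n} {w} → (x , y) ∈ blues w →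
  ∃[ p ] ∃[ u ] ∃[ v ] ∃[ q ] (Rotated w (p ∷ʳ (u , y)) × p ∷ʳ (u , y) ≡ (x , v) ∷ q)
around-blue {x = x} {y} {w@(a ∷ _)} e∈ with ∈-bluesTo⁻ w e∈
... | inj₁ (p , u , v , q , eq) = (x , v) ∷ q ++ p , u , v , q ++ p ∷ʳ (u , y) ,
      subst (λ w → Rotated w ((x , v) ∷ (q ++ p) ∷ʳ (u , y))) (sym (trans eq (sym (++-assoc p _ _))))
        (subst (Rotated _) (cong ((x , v) ∷_) (sym (++-assoc q p _)))
          (rotate (p ∷ʳ (u , y)) ((x , v) ∷ q))) ,
      cong ((x , v) ∷_) (++-assoc q p _)
... | inj₂ (p , u , eq , refl) = p , u , proj₂ a , _ ,
  (↭-reflexive eq , ↭-reflexive (cong blues eq)) , sym eq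

rotated-⟶ : ∀ {w w′ : Walk n} {ws es ds} → Rotated w w′ → w′ ∷ ws ⟶[ es ] ds → w ∷ ws ⟶[ es ] ds
rotated-⟶ {ws = ws} (p , q) (rewrites r b v) = rewrites
  (↭-trans (++⁺ʳ (concat ws) p) r) (↭-trans (++⁺ʳ (blueArcs ws) q) b)
  (≤-trans v (≤-reflexive (cong (λ k → k ∸ 1 + value ws) (sym (↭-length p)))))

⟶-trans : ∀ {cs ds ws : List (Walk n)} {es fs} →
  cs ⟶[ es ] ds → ds ⟶[ fs ] ws → cs ⟶[ es ++ fs ] ws
⟶-trans {es = es} {fs} (rewrites r b v) (rewrites r′ b′ v′) = rewrites
  (↭-trans r (↭-trans (++⁺ˡ es r′) (↭-reflexive (sym (++-assoc es fs _)))))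
  (↭-trans b (↭-trans (++⁺ˡ es b′) (↭-reflexive (sym (++-assoc es fs _)))))
  (≤-trans v′ v)

record Splits (w p q : Walk n) : Set where
  constructor splits
  field
    split-reds  : w ↭ p ++ q
    split-blues : blues w ↭ blues p ++ blues q
    nonempty₁   : 1 ≤ length p
    nonempty₂   : 1 ≤ length q

value-split : ∀ {w p q : Walk n} → Splits w p q → value (p ∷ q ∷ []) < value (w ∷ [])
value-split {p = _ ∷ p} {b ∷ q} (splits r _ _ _) = begin
  suc (length p + (length q + 0))  ≡⟨ +-suc (length p) _ ⟨
  length p + (suc (length q) + 0)  ≡⟨ +-assoc (length p) _ 0 ⟨
  length p + suc (length q) + 0    ≡⟨ cong (_+ 0) (length-++ p) ⟨
  length (p ++ b ∷ q) + 0          ≡⟨ cong (λ k → k ∸ 1 + 0) (↭-length r) ⟨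
  _                                ∎
  where open ≤-Reasoning

split-⟶ : ∀ {w p q : Walk n} → Splits w p q → w ∷ [] ⟶[ [] ] p ∷ q ∷ []
split-⟶ {p = p} {q} s@(splits r b _ _) = rewrites
  (↭-trans (++⁺ʳ [] r) (↭-reflexive (++-assoc p q [])))
  (↭-trans (++⁺ʳ [] b) (↭-reflexive (++-assoc (blues p) (blues q) [])))
  (<⇒≤ (value-split s))

remove-⟶ : ∀ {x y u : Fin n} p →
  ((x , y) ∷ p ∷ʳ (u , y)) ∷ [] ⟶[ (x , y) ∷ [] ] (p ∷ʳ (u , y)) ∷ []
remove-⟶ p = rewrites ↭-refl (++⁺ʳ [] (blues-remove p)) (+-monoˡ-≤ 0 (m∸n≤m (length (p ∷ʳ _)) 1))

-- With the red copy in front, the blue copy leads the walk back to `x`. Splitting there makes the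
-- blue copy the closing arc of the part that begins with the red copy, where `remove-⟶` applies.
cancel-same : ∀ {e : Pair n} {w} → e ∈ w → e ∈ blues w → ∃[ ds ] w ∷ [] ⟶[ e ∷ [] ] ds
cancel-same {e = x , y} {w} e∈w e∈blues with starting-at e∈w
... | r , rot with ∈-bluesTo⁻ ((x , y) ∷ r) (∈-resp-↭ (proj₂ rot) e∈blues)
-- The blue copy directly follows the red one, so the walk returns to `x` at once.
...   | inj₁ ([] , u , v , q , refl) = r ∷ [] , rotated-⟶ rot (rewrites ↭-refl ↭-refl (n≤1+n _))
...   | inj₁ (_ ∷ p , u , v , q , refl) = _ , rotated-⟶ rot
          (⟶-trans (split-⟶ {p = (x , y) ∷ p ∷ʳ (u , y)} {(x , v) ∷ q} (splits
              (↭-reflexive (cong ((x , y) ∷_) (sym (++-assoc p _ _))))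
              (↭-reflexive (trans (cong (blues ∘ ((x , y) ∷_)) (sym (++-assoc p _ _)))
                (blues-splitˣ (p ∷ʳ (u , y)) q)))
              (s≤s z≤n) (s≤s z≤n)))
            (⟶-within ↭-refl (remove-⟶ p)))
-- The walk consists of `e` alone and disappears.
...   | inj₂ ([] , u , refl , _) = [] , rotated-⟶ rot (rewrites ↭-refl ↭-refl z≤n)
...   | inj₂ (_ ∷ p , u , refl , _) = _ , rotated-⟶ rot (remove-⟶ p)

-- The two walks are joined at the common first vertex of the arc before it is removed.
cancel-different : ∀ {e : Pair n} {w₁ w₂} → e ∈ w₁ → e ∈ blues w₂ →
  ∃[ ds ] w₁ ∷ w₂ ∷ [] ⟶[ e ∷ [] ] ds
cancel-different {e = e@(x , y)} {w₁} {w₂} e∈w₁ e∈blues with starting-at e∈w₁ | around-blue e∈blues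
... | r , red-rot , blue-rot | p , u , v , q , (red-rot₂ , blue-rot₂) , eq =
  ((r ++ p) ∷ʳ (u , y)) ∷ [] , rewrites
    (begin
      w₁ ++ w₂ ++ []                    ↭⟨ ++⁺ red-rot (++⁺ʳ [] red-rot₂) ⟩
      e ∷ r ++ (p ∷ʳ (u , y)) ++ []     ≡⟨ cong (e ∷_) (++-assoc r (p ∷ʳ (u , y)) []) ⟨
      e ∷ (r ++ p ∷ʳ (u , y)) ++ []     ≡⟨ cong (λ l → e ∷ l ++ []) (++-assoc r p _) ⟨
      e ∷ ((r ++ p) ∷ʳ (u , y)) ++ []   ∎)
    (begin
      blues w₁ ++ blues w₂ ++ []                        ↭⟨ ++⁺ blue-rot (++⁺ʳ [] blue-rot₂) ⟩
      blues (e ∷ r) ++ blues (p ∷ʳ (u , y)) ++ []       ≡⟨ ++-assoc (blues (e ∷ r)) _ _ ⟨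
      (blues (e ∷ r) ++ blues (p ∷ʳ (u , y))) ++ []
        ≡⟨ cong (λ l → (blues (e ∷ r) ++ blues l) ++ []) eq ⟩
      (blues (e ∷ r) ++ blues ((x , v) ∷ q)) ++ []      ≡⟨ cong (_++ []) (blues-splitˣ r q) ⟨
      blues (e ∷ r ++ (x , v) ∷ q) ++ []                ≡⟨ cong (λ l → blues (e ∷ r ++ l) ++ []) eq ⟨
      blues (e ∷ r ++ p ∷ʳ (u , y)) ++ []
        ≡⟨ cong (λ l → blues (e ∷ l) ++ []) (++-assoc r p _) ⟨
      blues (e ∷ (r ++ p) ∷ʳ (u , y)) ++ []             ↭⟨ ++⁺ʳ [] (blues-remove (r ++ p)) ⟩
      e ∷ blues ((r ++ p) ∷ʳ (u , y)) ++ []             ∎)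
    value-joined
  where
  open Perm.PermutationReasoning
  length-∷ʳ : ∀ {A : Set} (xs : List A) {x} → length (xs ∷ʳ x) ≡ suc (length xs)
  length-∷ʳ xs = trans (length-++ xs) (+-comm (length xs) 1)
  length-joined : length ((r ++ p) ∷ʳ (u , y)) ≡ suc (length r + length p)
  length-joined = trans (length-∷ʳ (r ++ p)) (cong suc (length-++ r))
  value-joined : value (((r ++ p) ∷ʳ (u , y)) ∷ []) ≤ value (w₁ ∷ w₂ ∷ [])
  value-joined = ≤-reflexive (trans (cong (λ k → k ∸ 1 + 0) length-joined)
    (trans (+-assoc (length r) (length p) 0)
    (sym (cong₂ (λ j k → j ∸ 1 + (k ∸ 1 + 0)) (↭-length red-rot) (trans (↭-length red-rot₂) (length-∷ʳ p))))))

cancel : ∀ {e : Pair n} cs → e ∈ concat cs → e ∈ blueArcs cs → ∃[ ds ] cs ⟶[ e ∷ [] ] ds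
cancel {e = e} cs e∈reds e∈blues with ∈-concat⁻′ cs e∈reds
... | w₁ , e∈w₁ , w₁∈cs with ∈-∃++ w₁∈cs
... | ps , qs , refl with e ∈? blues w₁
...   | yes e∈blues₁ = _ , ⟶-within (shift w₁ ps qs) (proj₂ (cancel-same e∈w₁ e∈blues₁))
...   | no e∉blues₁ with ∈-++⁻ (blues w₁)
  (∈-resp-↭ (concat-resp-↭ (map⁺ blues (shift w₁ ps qs))) e∈blues)
...     | inj₁ e∈blues₁ = contradiction e∈blues₁ e∉blues₁
...     | inj₂ e∈rest with ∈-concat⁻′ (map blues (ps ++ qs)) e∈rest
...       | _ , e∈b , b∈ with ∈-map⁻ blues b∈
...         | w₂ , w₂∈ , refl with ∈-∃++ w₂∈
...           | ps′ , qs′ , eq = _ , ⟶-within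
                  (↭-trans (shift w₁ ps qs) (prep w₁ (↭-trans (↭-reflexive eq) (shift w₂ ps′ qs′))))
                  (proj₂ (cancel-different e∈w₁ e∈b))

-- Balanced and reduced collections

-- An arc may occur several times, and both as a red and as a blue arc.
Balanced : Digraph n → Digraph n → List (Walk n) → Set
Balanced G₁ G₂ cs = ∀ e → count e (concat cs) + ⟦ edge G₂ e ⟧ ≡ count e (blueArcs cs) + ⟦ edge G₁ e ⟧

-- A decomposition of the red-blue digraph into alternating circuits, expressed by multiplicities.
-- In this form it follows from `Balanced` by arithmetic and is decidable.
record Reduced (G₁ G₂ : Digraph n) (cs : List (Walk n)) : Set where
  field
    count-reds  : ∀ e → count e (concat cs) ≡ ⟦ edge G₁ e ∧ not (edge G₂ e) ⟧
    count-blues : ∀ e → count e (blueArcs cs) ≡ ⟦ edge G₂ e ∧ not (edge G₁ e) ⟧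
    nonempty    : All (λ w → 1 ≤ length w) cs

open Reduced public

⟶-balanced : ∀ {G₁ G₂ : Digraph n} {cs es ds} → cs ⟶[ es ] ds → Balanced G₁ G₂ cs → Balanced G₁ G₂ ds
⟶-balanced {G₁ = G₁} {G₂} {cs} {es} {ds} (rewrites r b _) bal e = +-cancelˡ-≡ (count e es) _ _ (begin
  count e es + (count e (concat ds) + ⟦ edge G₂ e ⟧)    ≡⟨ +-assoc (count e es) _ _ ⟨
  count e es + count e (concat ds) + ⟦ edge G₂ e ⟧
    ≡⟨ cong (_+ ⟦ edge G₂ e ⟧) (trans (count-resp-↭ e r) (count-++ e es _)) ⟨
  count e (concat cs) + ⟦ edge G₂ e ⟧                   ≡⟨ bal e ⟩
  count e (blueArcs cs) + ⟦ edge G₁ e ⟧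
    ≡⟨ cong (_+ ⟦ edge G₁ e ⟧) (trans (count-resp-↭ e b) (count-++ e es _)) ⟩
  count e es + count e (blueArcs ds) + ⟦ edge G₁ e ⟧    ≡⟨ +-assoc (count e es) _ _ ⟩
  count e es + (count e (blueArcs ds) + ⟦ edge G₁ e ⟧)  ∎)
  where open ≡-Reasoning

Disjoint : List (Walk n) → Set
Disjoint cs = ∀ {e} → e ∈ concat cs → e ∉ blueArcs cs

cancel-all : ∀ k (cs : List (Walk n)) → length (concat cs) ≤ k →
  ∃[ es ] ∃[ ds ] (cs ⟶[ es ] ds × Disjoint ds)
cancel-all k cs h with Any.any? (_∈? blueArcs cs) (concat cs)
... | no none = [] , cs , rewrites ↭-refl ↭-refl ≤-refl ,
      λ e∈r e∈b → none (Any.map (λ { refl → e∈b }) e∈r)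
... | yes some with find some
...   | e , e∈r , e∈b with cancel cs e∈r e∈b
...     | ds , step with k | ≤-trans (≤-reflexive (sym (↭-length (reds-↭ step)))) h
...       | suc k | s≤s h′ with cancel-all k ds h′
...         | es , ws , steps , disjoint = e ∷ es , ws , ⟶-trans step steps , disjoint

-- An empty walk has value 0 but would be counted as a circuit, which would spoil the identity
-- between H′, the value and the number of circuits.
drop-empty : List (Walk n) → List (Walk n)
drop-empty []             = []
drop-empty ([] ∷ cs)      = drop-empty cs
drop-empty (w@(_ ∷ _) ∷ cs) = w ∷ drop-empty cs

drop-empty-nonempty : ∀ (cs : List (Walk n)) → All (λ w → 1 ≤ length w) (drop-empty cs)
drop-empty-nonempty []             = []
drop-empty-nonempty ([] ∷ cs)      = drop-empty-nonempty cs
drop-empty-nonempty ((_ ∷ _) ∷ cs) = s≤s z≤n ∷ drop-empty-nonempty cs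

drop-empty-⟶ : ∀ (cs : List (Walk n)) → cs ⟶[ [] ] drop-empty cs
drop-empty-⟶ []             = rewrites ↭-refl ↭-refl ≤-refl
drop-empty-⟶ ([] ∷ cs)      with drop-empty-⟶ cs
... | rewrites r b v = rewrites r b v
drop-empty-⟶ (w@(_ ∷ w′) ∷ cs) with drop-empty-⟶ cs
... | rewrites r b v = rewrites (++⁺ˡ w r) (++⁺ˡ (blues w) b) (+-monoʳ-≤ (length w′) v)

-- Once no arc carries both colours, one of the two counts in the balance identity is zero, and the
-- identity determines the other from the two edge indicators.
reduce : ∀ {G₁ G₂ : Digraph n} {cs} → Balanced G₁ G₂ cs →
  ∃[ ds ] (Reduced G₁ G₂ ds × value ds ≤ value cs)
reduce {G₁ = G₁} {G₂} {cs} bal with cancel-all (length (concat cs)) cs ≤-refl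
... | es , ws , steps , disjoint = drop-empty ws , record
    { count-reds  = λ e → trans (sym (count-resp-↭ e (reds-↭ dropping))) (proj₁ (counts e))
    ; count-blues = λ e → trans (sym (count-resp-↭ e (blues-↭ dropping))) (proj₂ (counts e))
    ; nonempty    = drop-empty-nonempty ws
    } , ≤-trans (value-≤ dropping) (value-≤ steps)
  where
  dropping = drop-empty-⟶ ws
  bal′ : Balanced G₁ G₂ ws
  bal′ = ⟶-balanced {G₁ = G₁} {G₂} steps bal
  cases : ∀ r b g₁ g₂ → r + ⟦ g₂ ⟧ ≡ b + ⟦ g₁ ⟧ → r ≡ 0 ⊎ b ≡ 0 →
    r ≡ ⟦ g₁ ∧ not g₂ ⟧ × b ≡ ⟦ g₂ ∧ not g₁ ⟧
  cases .0 b       true  true  eq (inj₁ refl) = refl , sym (+-cancelʳ-≡ 1 0 b eq)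
  cases .0 b       true  false eq (inj₁ refl) = contradiction (trans eq (+-comm b 1)) λ ()
  cases .0 b       false true  eq (inj₁ refl) = refl , sym (trans eq (+-identityʳ b))
  cases .0 b       false false eq (inj₁ refl) = refl , sym (trans eq (+-identityʳ b))
  cases r .0       true  true  eq (inj₂ refl) = +-cancelʳ-≡ 1 r 0 eq , refl
  cases r .0       true  false eq (inj₂ refl) = trans (sym (+-identityʳ r)) eq , refl
  cases r .0       false true  eq (inj₂ refl) = contradiction (trans (sym eq) (+-comm r 1)) λ ()
  cases r .0       false false eq (inj₂ refl) = trans (sym (+-identityʳ r)) eq , refl
  one-zero : ∀ e → count e (concat ws) ≡ 0 ⊎ count e (blueArcs ws) ≡ 0
  one-zero e with e ∈? concat ws
  ... | yes e∈r = inj₂ (∉⇒count≡0 _ (disjoint e∈r))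
  ... | no e∉r  = inj₁ (∉⇒count≡0 _ e∉r)
  counts : ∀ e → count e (concat ws) ≡ ⟦ edge G₁ e ∧ not (edge G₂ e) ⟧
               × count e (blueArcs ws) ≡ ⟦ edge G₂ e ∧ not (edge G₁ e) ⟧
  counts e = cases _ _ (edge G₁ e) (edge G₂ e) (bal′ e) (one-zero e)

-- Swap sequences as collections of walks

balanced-++ : ∀ {G₁ M G₂ : Digraph n} cs {ds} →
  Balanced G₁ M cs → Balanced M G₂ ds → Balanced G₁ G₂ (cs ++ ds)
balanced-++ {G₁ = G₁} {M} {G₂} cs {ds} bal bal′ e
  rewrite sym (concat-++ cs ds) | blueArcs-++ cs ds
        | count-++ e (concat cs) (concat ds) | count-++ e (blueArcs cs) (blueArcs ds) = begin
  r + r′ + g₂     ≡⟨ +-assoc r r′ g₂ ⟩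
  r + (r′ + g₂)   ≡⟨ cong (r +_) (bal′ e) ⟩
  r + (b′ + m)    ≡⟨ solve 3 (λ r b m → r :+ (b :+ m) := (r :+ m) :+ b) refl r b′ m ⟩
  (r + m) + b′    ≡⟨ cong (_+ b′) (bal e) ⟩
  (b + g₁) + b′   ≡⟨ solve 3 (λ b g c → (b :+ g) :+ c := (b :+ c) :+ g) refl b g₁ b′ ⟩
  b + b′ + g₁     ∎
  where
  open ≡-Reasoning
  open +-*-Solver using (solve; _:+_; _:=_)
  r  = count e (concat cs)
  r′ = count e (concat ds)
  b  = count e (blueArcs cs)
  b′ = count e (blueArcs ds)
  g₁ = ⟦ edge G₁ e ⟧
  g₂ = ⟦ edge G₂ e ⟧
  m  = ⟦ edge M e ⟧

exchange-count : ∀ {G G′ : Digraph n} {es ns} → Unique es → Unique ns → Exchange G es ns G′ →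
  ∀ e → count e es + ⟦ edge G′ e ⟧ ≡ count e ns + ⟦ edge G e ⟧
exchange-count {es = es} {ns} ues uns ex e with e ∈? es | e ∈? ns
... | yes e∈es | yes e∈ns = contradiction
      (trans (sym (All.lookup (Exchange.es-edges ex) e∈es))
        (All.lookup (Exchange.ns-nonEdges ex) e∈ns)) λ ()
... | yes e∈es | no e∉ns
  rewrite Unique⇒count≡1 ues e∈es | ∉⇒count≡0 ns e∉ns
        | All.lookup (Exchange.es-edges ex) e∈es | All.lookup (Exchange.es-removed ex) e∈es = refl
... | no e∉es  | yes e∈ns
  rewrite Unique⇒count≡1 uns e∈ns | ∉⇒count≡0 es e∉es
        | All.lookup (Exchange.ns-nonEdges ex) e∈ns | All.lookup (Exchange.ns-added ex) e∈ns = refl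
... | no e∉es  | no e∉ns
  rewrite ∉⇒count≡0 es e∉es | ∉⇒count≡0 ns e∉ns =
  cong ⟦_⟧ (Exchange.elsewhere ex e (Sum.[ e∉es , e∉ns ] ∘ ∈-++⁻ es))

-- A C₄-swap is a closed walk with two red arcs, a C₆-swap one with three; their values are exactly
-- the weights 1 and 2.
swap-balanced : ∀ {G G′ : Digraph n} (s : Swap G G′) →
  ∃[ w ] (Balanced G G′ (w ∷ []) × length w ∸ 1 ≡ swapWeight s)
swap-balanced {G = G} {G′} (c₄ s) = (x , y) ∷ (z , t) ∷ [] , (λ e → begin
  count e ((x , y) ∷ (z , t) ∷ []) + ⟦ edge G′ e ⟧
    ≡⟨ exchange-count {G = G} {G′} ((distinct ∷ []) ∷ [] ∷ []) ((distinct ∷ []) ∷ [] ∷ []) exchange e ⟩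
  count e ((x , t) ∷ (z , y) ∷ []) + ⟦ edge G e ⟧
    ≡⟨ cong (_+ ⟦ edge G e ⟧) (count-resp-↭ e (Perm.swap (x , t) (z , y) (↭-refl {x = []}))) ⟩
  count e ((z , y) ∷ (x , t) ∷ []) + ⟦ edge G e ⟧  ∎) , refl
  where
  open ≡-Reasoning
  open C₄Swap s
  distinct : ∀ {a b : Fin _} → (x , a) ≢ (z , b)
  distinct eq = x≢z (cong proj₁ eq)
swap-balanced {G = G} {G′} (c₆ s) = (x₁ , y₁) ∷ (x₂ , y₂) ∷ (x₃ , y₃) ∷ [] ,
  (exchange-count {G = G} {G′}
    ((apart (proj₁ distinctU) ∷ apart (proj₂ (proj₂ distinctU) ∘ sym) ∷ []) ∷
      (apart (proj₁ (proj₂ distinctU)) ∷ []) ∷ [] ∷ [])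
    ((apart (proj₁ (proj₂ distinctU)) ∷ apart (proj₁ distinctU ∘ sym) ∷ []) ∷
      (apart (proj₂ (proj₂ distinctU)) ∷ []) ∷ [] ∷ [])
    exchange) , refl
  where
  open C₆Swap s
  apart : ∀ {u v a b : Fin _} → u ≢ v → (u , a) ≢ (v , b)
  apart u≢v eq = u≢v (cong proj₁ eq)

swaps-balanced : ∀ {G₁ G₂ : Digraph n} (ss : SwapSequence G₁ G₂) →
  ∃[ cs ] (Balanced G₁ G₂ cs × value cs ≡ weight ss)
swaps-balanced (done G≐H) = [] , (λ e → cong ⟦_⟧ (sym (G≐H e))) , refl
swaps-balanced {G₁ = G₁} {G₂} (_∷_ {G′ = M} s ss) with swap-balanced s | swaps-balanced ss
... | w , bal , eq | cs , bal′ , eq′ =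
  w ∷ cs , balanced-++ {G₁ = G₁} {M} {G₂} (w ∷ []) {cs} bal bal′ , cong₂ _+_ eq eq′

-- Reduced collections and the symmetric difference

pairs : ∀ n → List (Pair n)
pairs n = cartesianProduct (allFin n) (allFin n)

count-filterᵇ : ∀ p (e : Pair n) xs → count e (filterᵇ p xs) ≡ (if p e then count e xs else 0)
count-filterᵇ p e [] with p e
... | true  = refl
... | false = refl
count-filterᵇ p e (x ∷ xs) with e ≟ₚ x
... | yes refl with p e in eq
...   | true  = trans (count-here e (filterᵇ p xs))
  (cong suc (trans (count-filterᵇ p e xs) (cong (if_then count e xs else 0) eq)))
...   | false = trans (count-filterᵇ p e xs) (cong (if_then count e xs else 0) eq)
count-filterᵇ p e (x ∷ xs) | no e≢x with p x
...   | true  = trans (count-there (filterᵇ p xs) e≢x) (count-filterᵇ p e xs)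
...   | false = count-filterᵇ p e xs

count-pairs : ∀ p (e : Pair n) → count e (filterᵇ p (pairs n)) ≡ ⟦ p e ⟧
count-pairs {n} p e@(x , y) rewrite count-filterᵇ p e (pairs n)
  | Unique⇒count≡1 (cartesianProduct⁺ (allFin⁺ n) (allFin⁺ n))
    (∈-cartesianProduct⁺ (∈-allFin x) (∈-allFin y))
  with p e
... | true  = refl
... | false = refl

reduced-arcs : ∀ {G₁ G₂ : Digraph n} {cs} → Reduced G₁ G₂ cs →
  concat cs ++ blueArcs cs ↭ symmetricDifference G₁ G₂
reduced-arcs {G₁ = G₁} {G₂} {cs} red = count⇒↭ _ _ λ e →
  trans (count-++ e (concat cs) (blueArcs cs))
  (trans (cong₂ _+_ (count-reds red e) (count-blues red e))
  (trans (xor-count (edge G₁ e) (edge G₂ e)) (sym (count-pairs _ e))))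
  where
  xor-count : ∀ a b → ⟦ a ∧ not b ⟧ + ⟦ b ∧ not a ⟧ ≡ ⟦ a xor b ⟧
  xor-count true  true  = refl
  xor-count true  false = refl
  xor-count false true  = refl
  xor-count false false = refl

difference-bit : ∀ a b → 1 ≤ ⟦ a ∧ not b ⟧ → a ≡ true × b ≡ false
difference-bit true  false _ = refl , refl
difference-bit true  true  ()
difference-bit false _     ()

reduced-reds : ∀ {G₁ G₂ : Digraph n} {cs} → Reduced G₁ G₂ cs → All (Red G₁ G₂) (concat cs)
reduced-reds red = All.tabulate λ {e} e∈ →
  difference-bit _ _ (subst (1 ≤_) (count-reds red e) (∈⇒count>0 e∈))

reduced-blues : ∀ {G₁ G₂ : Digraph n} {cs} → Reduced G₁ G₂ cs → All (Blue G₁ G₂) (blueArcs cs)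
reduced-blues red = All.tabulate λ {e} e∈ →
  difference-bit _ _ (subst (1 ≤_) (count-blues red e) (∈⇒count>0 e∈))

length-blueArcs : ∀ (cs : List (Walk n)) → length (blueArcs cs) ≡ length (concat cs)
length-blueArcs []       = refl
length-blueArcs (w ∷ cs) = trans (length-++ (blues w))
  (trans (cong₂ _+_ (length-blues w) (length-blueArcs cs)) (sym (length-++ w)))

length-concat : ∀ (cs : List (Walk n)) → All (λ w → 1 ≤ length w) cs →
  length (concat cs) ≡ value cs + length cs
length-concat []             []       = refl
length-concat ((a ∷ w) ∷ cs) (_ ∷ ne) =
  trans (cong suc (trans (length-++ w) (cong (length w +_) (length-concat cs ne))))
  (trans (cong suc (sym (+-assoc (length w) (value cs) (length cs)))) (sym (+-suc _ (length cs))))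

-- A closed walk has as many blue as red arcs, so half the symmetric difference is the number of red
-- arcs. As the sum does not depend on `cs`, least value means most circuits.
H′-reduced : ∀ {G₁ G₂ : Digraph n} {cs} → Reduced G₁ G₂ cs → H′ G₁ G₂ ≡ value cs + length cs
H′-reduced {G₁ = G₁} {G₂} {cs} red = begin
  length (symmetricDifference G₁ G₂) / 2          ≡⟨ cong (_/ 2) (↭-length (reduced-arcs red)) ⟨
  length (concat cs ++ blueArcs cs) / 2           ≡⟨ cong (_/ 2) (length-++ (concat cs)) ⟩
  (m + length (blueArcs cs)) / 2                  ≡⟨ cong (λ k → (m + k) / 2) (length-blueArcs cs) ⟩
  (m + m) / 2
    ≡⟨ cong (_/ 2) (trans (cong (m +_) (sym (+-identityʳ m))) (*-comm 2 m)) ⟩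
  m * 2 / 2                                       ≡⟨ m*n/n≡m m 2 ⟩
  m                                               ≡⟨ length-concat cs (nonempty red) ⟩
  value cs + length cs                            ∎
  where
  open ≡-Reasoning
  m = length (concat cs)

-- Walks and alternating circuits

steps : Walk n → Fin n → List (Step n)
steps []            z = []
steps ((x , y) ∷ w) z = along (x , y) ∷ against (next w z , y) ∷ steps w z

circuit : Walk n → List (Step n)
circuit []              = []
circuit w@((x , _) ∷ _) = steps w x

arcs-steps : ∀ (w : Walk n) z → map arc (steps w z) ↭ w ++ bluesTo w z
arcs-steps []            z = ↭-refl
arcs-steps ((x , y) ∷ w) z =
  prep (x , y) (↭-trans (prep _ (arcs-steps w z)) (↭-sym (shift (next w z , y) w (bluesTo w z))))

arcs-circuit : ∀ (w : Walk n) → map arc (circuit w) ↭ w ++ blues w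
arcs-circuit []              = ↭-refl
arcs-circuit w@((x , _) ∷ _) = arcs-steps w x

arcs-circuits : ∀ (cs : List (Walk n)) → map arc (concat (map circuit cs)) ↭ concat cs ++ blueArcs cs
arcs-circuits []       = ↭-refl
arcs-circuits (w ∷ cs) = begin
  map arc (circuit w ++ concat (map circuit cs))          ≡⟨ map-++ arc (circuit w) _ ⟩
  map arc (circuit w) ++ map arc (concat (map circuit cs)) ↭⟨ ++⁺ (arcs-circuit w) (arcs-circuits cs) ⟩
  (w ++ blues w) ++ (concat cs ++ blueArcs cs)            ≡⟨ ++-assoc w (blues w) _ ⟩
  w ++ blues w ++ concat cs ++ blueArcs cs                ↭⟨ ++⁺ˡ w (shifts (blues w) (concat cs)) ⟩
  w ++ concat cs ++ blues w ++ blueArcs cs                ≡⟨ ++-assoc w (concat cs) _ ⟨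
  (w ++ concat cs) ++ blues w ++ blueArcs cs              ∎
  where open Perm.PermutationReasoning

module _ (G₁ G₂ : Digraph n) where

  -- The appended step plays the part of the repeated first step in `AlternatingCircuit`; it enters
  -- through its start `z`, at which the walk closes.
  steps-linked : ∀ (w : Walk n) z y′ → All (Red G₁ G₂) w → All (Blue G₁ G₂) (bluesTo w z) →
    Red G₁ G₂ (z , y′) →
    Linked (Alternates G₁ G₂) (steps w z ∷ʳ along (z , y′))
  against-linked : ∀ (w : Walk n) z y y′ → Blue G₁ G₂ (next w z , y) →
    All (Red G₁ G₂) w → All (Blue G₁ G₂) (bluesTo w z) → Red G₁ G₂ (z , y′) →
    Linked (Alternates G₁ G₂) (against (next w z , y) ∷ (steps w z ∷ʳ along (z , y′)))

  steps-linked []            z y′ reds        blues        red = [-]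
  steps-linked ((x , y) ∷ w) z y′ (r ∷ reds) (b ∷ blues) red =
    record { consecutive = refl ; colors = inj₁ (r , b) ; directions = inj₁ (refl , refl) }
    ∷ against-linked w z y y′ b reds blues red

  against-linked [] z y y′ b reds blues red =
    record { consecutive = refl ; colors = inj₂ (b , red) ; directions = inj₂ (refl , refl) } ∷ [-]
  against-linked w@(_ ∷ _) z y y′ b reds@(r ∷ _) blues red =
    record { consecutive = refl ; colors = inj₂ (b , r) ; directions = inj₂ (refl , refl) }
    ∷ steps-linked w z y′ reds blues red

  alternatingCircuit : ∀ {w : Walk n} → 1 ≤ length w → All (Red G₁ G₂) w → All (Blue G₁ G₂) (blues w) →
    Unique (w ++ blues w) → AlternatingCircuit G₁ G₂ (circuit w)
  alternatingCircuit {w@((x , y) ∷ _)} _ reds@(r ∷ _) blues unique =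
    count≤1⇒Unique _ (λ e → ≤-trans (≤-reflexive (count-resp-↭ e (arcs-circuit w)))
      (Unique⇒count≤1 unique e)) ,
    steps-linked w x y reds blues r

  reduced-decomposition : ∀ {cs} → Reduced G₁ G₂ cs → IsDecomposition G₁ G₂ (map circuit cs)
  reduced-decomposition {cs} red =
    All.map⁺ (All.tabulate λ {w} w∈cs → alternatingCircuit (All.lookup (nonempty red) w∈cs)
      (All.tabulate λ e∈w → All.lookup (reduced-reds red) (∈-concat⁺′ e∈w w∈cs))
      (All.tabulate λ e∈b → All.lookup (reduced-blues red) (∈-concat⁺′ e∈b (∈-map⁺ blues w∈cs)))
      (count≤1⇒Unique _ λ e → ≤-trans (part e w∈cs) (at-most-one e))) ,
    ↭-trans (arcs-circuits cs) (reduced-arcs red)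
    where
    at-most-one : ∀ e → count e (concat cs ++ blueArcs cs) ≤ 1
    at-most-one e = subst (_≤ 1) (sym (trans (count-resp-↭ e (reduced-arcs red)) (count-pairs _ e)))
      (⟦⟧≤1 _)
      where
      ⟦⟧≤1 : ∀ b → ⟦ b ⟧ ≤ 1
      ⟦⟧≤1 true  = s≤s z≤n
      ⟦⟧≤1 false = z≤n
    part : ∀ e {w} → w ∈ cs → count e (w ++ blues w) ≤ count e (concat cs ++ blueArcs cs)
    part e {w} w∈cs with ∈-∃++ w∈cs
    ... | ps , qs , refl = begin
      count e (w ++ blues w) ≡⟨ count-++ e w (blues w) ⟩
      count e w + count e (blues w) ≤⟨ +-mono-≤ (m≤m+n (count e w) _) (m≤m+n (count e (blues w)) _) ⟩
      (count e w + count e (concat (ps ++ qs))) + (count e (blues w) + count e (blueArcs (ps ++ qs)))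
        ≡⟨ cong₂ _+_ (trans (sym (count-++ e w _))
          (sym (count-resp-↭ e (concat-resp-↭ (shift w ps qs)))))
                     (trans (sym (count-++ e (blues w) _))
                       (sym (count-resp-↭ e (concat-resp-↭ (map⁺ blues (shift w ps qs)))))) ⟩
      count e (concat cs) + count e (blueArcs cs)   ≡⟨ count-++ e (concat cs) _ ⟨
      count e (concat cs ++ blueArcs cs) ∎
      where open ≤-Reasoning

-- Serves to compare the last step of a traced list with the prescribed repetition of the first one,
-- which excludes the wrong parity.
steps-last : ∀ (a : Pair n) w z → ∃[ l ] ∃[ y ] steps (a ∷ w) z ≡ l ∷ʳ against (z , y)
steps-last (x , y) []      z = along (x , y) ∷ [] , y , refl
steps-last (x , y) (b ∷ w) z with steps-last b w z
... | l , y′ , eq = along (x , y) ∷ against (proj₁ b , y) ∷ l , y′ ,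
      cong (λ l → along (x , y) ∷ against (proj₁ b , y) ∷ l) eq

RedWalk : Digraph n → Digraph n → Walk n → Fin n → Set
RedWalk G₁ G₂ w z = All (Red G₁ G₂) w × All (Blue G₁ G₂) (bluesTo w z)

edge⇒chord : ∀ (G : Digraph n) {e} → Edge G e → Chord e
edge⇒chord G {x , _} e refl = contradiction (trans (sym e) (loopless G x)) λ ()

red⇒¬blue : ∀ {G₁ G₂ : Digraph n} {e} → Red G₁ G₂ e → ¬ Blue G₁ G₂ e
red⇒¬blue (p , _) (_ , q) = contradiction (trans (sym p) q) λ ()

module _ {G₁ G₂ : Digraph n} where

  -- If the next step also ran along its arc, the common vertex would be both ends of one of the two
  -- arcs, and neither digraph has a loop. `against-next` holds for the same reason.
  along-next : ∀ {x y s} → Red G₁ G₂ (x , y) → Alternates G₁ G₂ (along (x , y)) s →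
    ∃[ x′ ] (s ≡ against (x′ , y) × Blue G₁ G₂ (x′ , y))
  along-next red record { colors = inj₂ (b , _) } = contradiction b (red⇒¬blue {G₁ = G₁} {G₂} red)
  along-next {s = along _} red record
    { consecutive = refl ; colors = inj₁ (_ , b) ; directions = inj₁ (_ , refl) } =
    contradiction refl (edge⇒chord G₂ (proj₁ b))
  along-next {s = along _} red record { directions = inj₂ (refl , _) } =
    contradiction refl (edge⇒chord G₁ (proj₁ red))
  along-next {s = against (x′ , _)} red record { consecutive = refl ; colors = inj₁ (_ , b) } =
    x′ , refl , b

  against-next : ∀ {x y s} → Blue G₁ G₂ (x , y) → Alternates G₁ G₂ (against (x , y)) s →
    ∃[ y′ ] (s ≡ along (x , y′) × Red G₁ G₂ (x , y′))
  against-next blue record { colors = inj₁ (r , _) } = contradiction blue (red⇒¬blue {G₁ = G₁} {G₂} r)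
  against-next {s = against _} blue record
    { consecutive = refl ; colors = inj₂ (_ , r) ; directions = inj₂ (_ , refl) } =
    contradiction refl (edge⇒chord G₁ (proj₁ r))
  against-next {s = against _} blue record { directions = inj₁ (refl , _) } =
    contradiction refl (edge⇒chord G₂ (proj₁ blue))
  against-next {s = along (_ , y′)} blue record { consecutive = refl ; colors = inj₂ (_ , r) } =
    y′ , refl , r

  -- The steps come in pairs, a red arc forwards and a blue arc backwards. The two outcomes
  -- distinguish whether the list ends with a blue or with a red step.
  trace : ∀ x y l → Red G₁ G₂ (x , y) → Linked (Alternates G₁ G₂) (along (x , y) ∷ l) →
    (∃[ w ] ∃[ z ] (along (x , y) ∷ l ≡ steps ((x , y) ∷ w) z × RedWalk G₁ G₂ ((x , y) ∷ w) z))
    ⊎ (∃[ w ] ∃[ z ] ∃[ y′ ]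
      (along (x , y) ∷ l ≡ steps w z ∷ʳ along (z , y′) × next w z ≡ x × RedWalk G₁ G₂ w z))
  trace x y [] red _ = inj₂ ([] , x , y , refl , refl , [] , [])
  trace x y (s ∷ l) red (alt ∷ linked) with along-next red alt
  trace x y (s ∷ []) red (alt ∷ linked) | x′ , refl , blue = inj₁ ([] , x′ , refl , red ∷ [] , blue ∷ [])
  trace x y (s ∷ s′ ∷ l) red (alt ∷ alt′ ∷ linked) | x′ , refl , blue with against-next blue alt′
  ... | y′ , refl , red′ with trace x′ y′ l red′ linked
  ...   | inj₁ (w , z , eq , reds , blues) =
          inj₁ ((x′ , y′) ∷ w , z , cong (λ l → along (x , y) ∷ against (x′ , y) ∷ l) eq ,
            red ∷ reds , blue ∷ blues)
  ...   | inj₂ (w , z , y″ , eq , refl , reds , blues) =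
          inj₂ ((x , y) ∷ w , z , y″ , cong (λ l → along (x , y) ∷ against (x′ , y) ∷ l) eq , refl ,
            red ∷ reds , blue ∷ blues)

record WalkOf (G₁ G₂ : Digraph n) (c : List (Step n)) : Set where
  constructor walkOf
  field
    walk       : Walk n
    walk-arcs  : map arc c ↭ walk ++ blues walk
    walk-reds  : All (Red G₁ G₂) walk
    walk-blues : All (Blue G₁ G₂) (blues walk)
    walk≢[]    : 1 ≤ length walk

module _ (G₁ G₂ : Digraph n) where

  walk-from-red : ∀ x y l → Red G₁ G₂ (x , y) →
    Linked (Alternates G₁ G₂) (along (x , y) ∷ (l ∷ʳ along (x , y))) → WalkOf G₁ G₂ (along (x , y) ∷ l)
  walk-from-red x y l red linked with trace x y (l ∷ʳ along (x , y)) red linked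
  ... | inj₁ (w , z , eq , _) with steps-last (x , y) w z
  ...   | k , y′ , eq′ = contradiction (∷ʳ-injectiveʳ (along (x , y) ∷ l) k (trans eq eq′)) λ ()
  walk-from-red x y l red linked
      | inj₂ (w , z , y′ , eq , nxt , reds , blue-arcs)
      with ∷ʳ-injectiveʳ (along (x , y) ∷ l) (steps w z) eq
         | ∷ʳ-injectiveˡ (along (x , y) ∷ l) (steps w z) eq
  walk-from-red x y l red linked
      | inj₂ (w@(_ ∷ _) , z , y′ , eq , refl , reds , blue-arcs) | refl | eq′ =
    walkOf w (↭-trans (↭-reflexive (cong (map arc) eq′)) (arcs-steps w z)) reds blue-arcs (s≤s z≤n)

  -- The walk is begun at the second step, which is red; the repetition of the first step at the end
  -- of the trail supplies its closing blue arc.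
  walk-from-blue : ∀ x y l → Blue G₁ G₂ (x , y) →
    Linked (Alternates G₁ G₂) (against (x , y) ∷ (l ∷ʳ against (x , y))) →
      WalkOf G₁ G₂ (against (x , y) ∷ l)
  walk-from-blue x y [] blue (alt ∷ _) with against-next blue alt
  ... | _ , () , _
  walk-from-blue x y (s ∷ l) blue (alt ∷ linked) with against-next blue alt
  ... | y′ , refl , red with trace x y′ (l ∷ʳ against (x , y)) red linked
  ...   | inj₂ (w , z , y″ , eq , _) =
          contradiction (∷ʳ-injectiveʳ (along (x , y′) ∷ l) (steps w z) eq) λ ()
  ...   | inj₁ (w , z , eq , reds , blue-arcs) with steps-last (x , y′) w z
  ...     | k , y″ , eq′ with ∷ʳ-injectiveʳ (along (x , y′) ∷ l) k (trans eq eq′)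
  ...       | refl = walkOf ((x , y′) ∷ w)
                (↭-trans (map⁺ arc (∷↭∷ʳ (against (x , y)) (along (x , y′) ∷ l)))
                  (↭-trans (↭-reflexive (cong (map arc) eq)) (arcs-steps ((x , y′) ∷ w) x)))
                reds blue-arcs (s≤s z≤n)

-- Interchanging the digraphs interchanges the colours, and so does reading the walk backwards.
reverse-walk : ∀ {G₁ G₂ : Digraph n} {c} → WalkOf G₂ G₁ c → WalkOf G₁ G₂ c
reverse-walk (walkOf w arcs reds blue-arcs ne) with blues-reverse w
... | w′ , p , q = walkOf w′ (↭-trans arcs (↭-trans (++-comm w (blues w)) (++⁺ (↭-sym p) (↭-sym q))))
      (All-resp-↭ (↭-sym p) blue-arcs) (All-resp-↭ (↭-sym q) reds)
      (subst (1 ≤_) (sym (trans (↭-length p) (length-blues w))) ne)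

alternates-recoloured : ∀ {G₁ G₂ : Digraph n} {s s′} → Alternates G₁ G₂ s s′ → Alternates G₂ G₁ s s′
alternates-recoloured alt = record
  { consecutive = consecutive ; colors = Sum.swap colors ; directions = directions }
  where open Alternates alt

circuit-walk : ∀ {G₁ G₂ : Digraph n} c → AlternatingCircuit G₁ G₂ c → WalkOf G₁ G₂ c
circuit-walk {G₁ = G₁} {G₂} (s ∷ l) (_ , linked) = start s l linked (first-colour l linked)
  where
  first-colour : ∀ {s} l {t} → Linked (Alternates G₁ G₂) (s ∷ (l ∷ʳ t)) →
    Red G₁ G₂ (arc s) ⊎ Blue G₁ G₂ (arc s)
  first-colour []      (alt ∷ _) = Sum.map proj₁ proj₁ (Alternates.colors alt)
  first-colour (_ ∷ _) (alt ∷ _) = Sum.map proj₁ proj₁ (Alternates.colors alt)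
  start : ∀ s l → Linked (Alternates G₁ G₂) (s ∷ (l ∷ʳ s)) → Red G₁ G₂ (arc s) ⊎ Blue G₁ G₂ (arc s) →
    WalkOf G₁ G₂ (s ∷ l)
  start (along (x , y))   l linked (inj₁ red)  = walk-from-red G₁ G₂ x y l red linked
  start (against (x , y)) l linked (inj₂ blue) = walk-from-blue G₁ G₂ x y l blue linked
  -- Traversing the red arcs against their direction is a forward traversal
  -- after an exchange of the two colours.
  start (along (x , y))   l linked (inj₂ blue) =
    reverse-walk (walk-from-red G₂ G₁ x y l blue (Linked.map alternates-recoloured linked))
  start (against (x , y)) l linked (inj₁ red)  =
    reverse-walk (walk-from-blue G₂ G₁ x y l red (Linked.map alternates-recoloured linked))

record WalksOf (G₁ G₂ : Digraph n) (cs : List (List (Step n))) : Set where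
  constructor walksOf
  field
    walks        : List (Walk n)
    walks-length : length walks ≡ length cs
    walks-arcs   : map arc (concat cs) ↭ concat walks ++ blueArcs walks
    walks-reds   : All (Red G₁ G₂) (concat walks)
    walks-blues  : All (Blue G₁ G₂) (blueArcs walks)
    walks≢[]     : All (λ w → 1 ≤ length w) walks

circuits-walks : ∀ {G₁ G₂ : Digraph n} {cs} → All (AlternatingCircuit G₁ G₂) cs → WalksOf G₁ G₂ cs
circuits-walks [] = walksOf [] refl ↭-refl [] [] []
circuits-walks {cs = c ∷ cs} (ac ∷ acs) with circuit-walk c ac | circuits-walks acs
... | walkOf w arcs reds blue-arcs ne | walksOf ws len arcs′ reds′ blues′ ne′ =
  walksOf (w ∷ ws) (cong suc len)
    (begin
      map arc (c ++ concat cs)                      ≡⟨ map-++ arc c (concat cs) ⟩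
      map arc c ++ map arc (concat cs)              ↭⟨ ++⁺ arcs arcs′ ⟩
      (w ++ blues w) ++ concat ws ++ blueArcs ws    ≡⟨ ++-assoc w (blues w) _ ⟩
      w ++ blues w ++ concat ws ++ blueArcs ws      ↭⟨ ++⁺ˡ w (shifts (blues w) (concat ws)) ⟩
      w ++ concat ws ++ blues w ++ blueArcs ws      ≡⟨ ++-assoc w (concat ws) _ ⟨
      (w ++ concat ws) ++ blues w ++ blueArcs ws    ∎)
    (All.++⁺ reds reds′) (All.++⁺ blue-arcs blues′) (ne ∷ ne′)
  where open Perm.PermutationReasoning

-- The permutation determines only the sum of the two counts of a pair; its colour shows which of
-- them is zero.
decomposition-reduced : ∀ {G₁ G₂ : Digraph n} {cs} → IsDecomposition G₁ G₂ cs →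
  ∃[ ws ] (Reduced G₁ G₂ ws × length ws ≡ length cs)
decomposition-reduced {G₁ = G₁} {G₂} {cs} (circuits , arcs) with circuits-walks circuits
... | walksOf ws len arcs′ reds blue-arcs ne = ws , record
    { count-reds  = λ e → proj₁ (counts e)
    ; count-blues = λ e → proj₂ (counts e)
    ; nonempty    = ne
    } , len
  where
  total : ∀ e → count e (concat ws) + count e (blueArcs ws) ≡ ⟦ edge G₁ e xor edge G₂ e ⟧
  total e = trans (sym (count-++ e (concat ws) _))
    (trans (count-resp-↭ e (↭-trans (↭-sym arcs′) arcs)) (count-pairs _ e))
  absent : ∀ {P : Pair _ → Set} {xs e} → All P xs → ¬ P e → count e xs ≡ 0
  absent {xs = xs} all ¬p = ∉⇒count≡0 xs (¬p ∘ All.lookup all)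
  counts : ∀ e → count e (concat ws) ≡ ⟦ edge G₁ e ∧ not (edge G₂ e) ⟧
               × count e (blueArcs ws) ≡ ⟦ edge G₂ e ∧ not (edge G₁ e) ⟧
  counts e with count e (concat ws) in r | count e (blueArcs ws) in b | edge G₁ e in g₁
    | edge G₂ e | total e
  ... | zero  | zero  | true  | true  | _ = refl , refl
  ... | zero  | zero  | false | false | _ = refl , refl
  ... | suc k | m     | true  | false | eq
    with refl ← trans (sym b)
      (absent blue-arcs λ blue → contradiction (trans (sym g₁) (proj₂ blue)) λ ()) =
    trans (sym (+-identityʳ _)) eq , refl
  ... | zero  | m     | true  | false | eq
    with refl ← trans (sym b)
      (absent blue-arcs λ blue → contradiction (trans (sym g₁) (proj₂ blue)) λ ()) =
    contradiction eq λ ()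
  ... | k     | m     | false | true  | eq
    with refl ← trans (sym r)
      (absent reds λ red → contradiction (trans (sym g₁) (proj₁ red)) λ ()) = refl , eq

-- Existence of a collection of least value

length-filterᵇ-tabulate : ∀ {A : Set} {m} (p : A → Bool) (f : Fin m → A) →
  length (filterᵇ p (tabulate f)) ≡ ∣ Vec.tabulate (p ∘ f) ∣
length-filterᵇ-tabulate {m = zero}  p f = refl
length-filterᵇ-tabulate {m = suc m} p f with p (f zero)
... | true  = cong suc (length-filterᵇ-tabulate p (f ∘ suc))
... | false = length-filterᵇ-tabulate p (f ∘ suc)

edges : Digraph n → List (Pair n)
edges {n} G = filterᵇ (edge G) (pairs n)

map-proj₁-row : ∀ (p : Pair n → Bool) x ys →
  map proj₁ (filterᵇ p (map (x ,_) ys)) ≡ replicate (length (filterᵇ (λ y → p (x , y)) ys)) x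
map-proj₁-row p x []       = refl
map-proj₁-row p x (y ∷ ys) with p (x , y)
... | true  = cong (x ∷_) (map-proj₁-row p x ys)
... | false = map-proj₁-row p x ys

map-proj₁-edges : ∀ (G : Digraph n) → map proj₁ (edges G) ≡
  concat (map (λ x → replicate (outDegree G x) x) (allFin n))
map-proj₁-edges {n} G = rows (allFin n)
  where
  rows : ∀ xs → map proj₁ (filterᵇ (edge G) (cartesianProduct xs (allFin n))) ≡
    concat (map (λ x → replicate (outDegree G x) x) xs)
  rows []       = refl
  rows (x ∷ xs) = trans (cong (map proj₁) (filter-++ (T? ∘ edge G) (map (x ,_) (allFin n)) _))
    (trans (map-++ proj₁ (filterᵇ (edge G) (map (x ,_) (allFin n))) _)
    (cong₂ _++_ (trans (map-proj₁-row (edge G) x (allFin n))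
                       (cong (λ k → replicate k x) (length-filterᵇ-tabulate (λ y → edge G (x , y)) id)))
                (rows xs)))

transposed : Pair n → Pair n
transposed (x , y) = y , x

transpose : Digraph n → Digraph n
transpose G = record { edge = edge G ∘ transposed ; loopless = loopless G }

count-map-transposed : ∀ (e : Pair n) xs → count e (map transposed xs) ≡ count (transposed e) xs
count-map-transposed e []       = refl
count-map-transposed e (x ∷ xs) with e ≟ₚ transposed x
... | yes refl = trans (cong suc (count-map-transposed e xs)) (sym (count-here x xs))
... | no e≢x   = trans (count-map-transposed e xs) (sym (count-there xs λ { refl → e≢x refl }))

edges-transpose : ∀ (G : Digraph n) → edges G ↭ map transposed (edges (transpose G))
edges-transpose G = count⇒↭ _ _ λ e → trans (count-pairs (edge G) e)
  (sym (trans (count-map-transposed e (edges (transpose G)))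
    (count-pairs (edge (transpose G)) (transposed e))))

same-outDegrees : ∀ {G₁ G₂ : Digraph n} → (∀ x → outDegree G₁ x ≡ outDegree G₂ x) →
  map proj₁ (edges G₁) ≡ map proj₁ (edges G₂)
same-outDegrees {G₁ = G₁} {G₂} same = trans (map-proj₁-edges G₁)
    (trans (cong concat (map-cong (λ x → cong (λ k → replicate k x) (same x)) (allFin _)))
      (sym (map-proj₁-edges G₂)))

map-proj₂-edges : ∀ (G : Digraph n) → map proj₂ (edges G) ↭ map proj₁ (edges (transpose G))
map-proj₂-edges G = ↭-trans (map⁺ proj₂ (edges-transpose G))
  (↭-reflexive (sym (map-∘ (edges (transpose G)))))

same-inDegrees : ∀ {G₁ G₂ : Digraph n} → (∀ x → inDegree G₁ x ≡ inDegree G₂ x) →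
  map proj₂ (edges G₁) ↭ map proj₂ (edges G₂)
same-inDegrees {G₁ = G₁} {G₂} same = ↭-trans (map-proj₂-edges G₁)
  (↭-trans (↭-reflexive (same-outDegrees {G₁ = transpose G₁} {transpose G₂} same))
    (↭-sym (map-proj₂-edges G₂)))

concat-doubletons : ∀ {A B : Set} (f g : A → B) xs →
  concat (map (λ a → f a ∷ g a ∷ []) xs) ↭ map f xs ++ map g xs
concat-doubletons f g []       = ↭-refl
concat-doubletons f g (x ∷ xs) =
  prep (f x) (↭-trans (prep (g x) (concat-doubletons f g xs))
  (↭-sym (shift (g x) (map f xs) (map g xs))))

-- The quadrangles through a fixed vertex o express a matrix with zero row and
-- column sums as Σ c(x,y) (e_xy − e_xo − e_oy + e_oo).
quadrangles-balanced : ∀ {m} {G₁ G₂ : Digraph (suc m)} →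
  (∀ x → outDegree G₁ x ≡ outDegree G₂ x) → (∀ x → inDegree G₁ x ≡ inDegree G₂ x) →
  ∃[ cs ] Balanced G₁ G₂ cs
quadrangles-balanced {m} {G₁} {G₂} outs ins = map pos (edges G₁) ++ map neg (edges G₂) , balanced
  where
  o : Fin (suc m)
  o = zero
  pos neg : Pair (suc m) → Walk (suc m)
  pos e = e ∷ (o , o) ∷ []
  neg e = (proj₁ e , o) ∷ (o , proj₂ e) ∷ []
  X Y O : Digraph (suc m) → List (Pair (suc m))
  X G = map (λ e → proj₁ e , o) (edges G)
  Y G = map (λ e → o , proj₂ e) (edges G)
  O G = map (λ e → o , o) (edges G)
  -- The contributions on the row and the column of `o` agree: `X` by equal out-degrees, `Y` by
  -- equal in-degrees, `O` by equal numbers of edges.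
  X-same : X G₁ ≡ X G₂
  X-same = trans (map-∘ (edges G₁))
    (trans (cong (map (_, o)) (same-outDegrees {G₁ = G₁} {G₂} outs)) (sym (map-∘ (edges G₂))))
  O-same : O G₁ ≡ O G₂
  O-same = trans (map-∘ (edges G₁))
    (trans (cong (map (λ _ → o , o)) (same-outDegrees {G₁ = G₁} {G₂} outs)) (sym (map-∘ (edges G₂))))
  Y-same : Y G₁ ↭ Y G₂
  Y-same = ↭-trans (↭-reflexive (map-∘ (edges G₁)))
    (↭-trans (map⁺ (o ,_) (same-inDegrees {G₁ = G₁} {G₂} ins)) (↭-reflexive (sym (map-∘ (edges G₂)))))
  reds : concat (map pos (edges G₁) ++ map neg (edges G₂)) ↭ (edges G₁ ++ O G₁) ++ (X G₂ ++ Y G₂)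
  reds = ↭-trans (↭-reflexive (sym (concat-++ (map pos (edges G₁)) _)))
    (++⁺ (↭-trans (concat-doubletons id (λ _ → o , o) (edges G₁))
      (↭-reflexive (cong (_++ O G₁) (map-id (edges G₁)))))
         (concat-doubletons (λ e → proj₁ e , o) (λ e → o , proj₂ e) (edges G₂)))
  blue-arcs : blueArcs (map pos (edges G₁) ++ map neg (edges G₂)) ↭ (Y G₁ ++ X G₁) ++ (O G₂ ++ edges G₂)
  blue-arcs = ↭-trans (↭-reflexive (blueArcs-++ (map pos (edges G₁)) _))
    (++⁺ (↭-trans (↭-reflexive (cong concat (sym (map-∘ (edges G₁)))))
            (concat-doubletons (λ e → o , proj₂ e) (λ e → proj₁ e , o) (edges G₁)))
         (↭-trans (↭-reflexive (cong concat (sym (map-∘ (edges G₂)))))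
           (↭-trans (concat-doubletons (λ _ → o , o) id (edges G₂))
             (↭-reflexive (cong (O G₂ ++_) (map-id (edges G₂)))))))
  balanced : Balanced G₁ G₂ (map pos (edges G₁) ++ map neg (edges G₂))
  balanced e rewrite count-resp-↭ e reds | count-resp-↭ e blue-arcs
    | count-++ e (edges G₁ ++ O G₁) (X G₂ ++ Y G₂) | count-++ e (edges G₁) (O G₁)
    | count-++ e (X G₂) (Y G₂)
    | count-++ e (Y G₁ ++ X G₁) (O G₂ ++ edges G₂) | count-++ e (Y G₁) (X G₁)
    | count-++ e (O G₂) (edges G₂)
    | count-pairs (edge G₁) e | count-pairs (edge G₂) e
    | X-same | O-same | count-resp-↭ e Y-same =
    solve 5 (λ a b c d f → a :+ c :+ (d :+ f) :+ b := f :+ d :+ (c :+ b) :+ a) refl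
      ⟦ edge G₁ e ⟧ ⟦ edge G₂ e ⟧ (count e (O G₂)) (count e (X G₂)) (count e (Y G₂))
    where open +-*-Solver using (solve; _:+_; _:=_)

realizations-balanced : ∀ {G₁ G₂ : Digraph n} {d⁺ d⁻} → Realizes G₁ d⁺ d⁻ → Realizes G₂ d⁺ d⁻ →
  ∃[ cs ] Balanced G₁ G₂ cs
realizations-balanced {zero}  _  _  = [] , λ ()
realizations-balanced {suc m} {G₁} {G₂} r₁ r₂ = quadrangles-balanced {G₁ = G₁} {G₂}
  (λ x → trans (proj₁ (r₁ x)) (sym (proj₁ (r₂ x))))
  (λ x → trans (proj₂ (r₁ x)) (sym (proj₂ (r₂ x))))

lists≤ : ∀ {A : Set} → ℕ → List A → List (List A)
lists≤ zero    xs = [] ∷ []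
lists≤ (suc k) xs = [] ∷ cartesianProductWith _∷_ xs (lists≤ k xs)

∈-lists≤ : ∀ {A : Set} {k} {xs l : List A} → length l ≤ k → All (_∈ xs) l → l ∈ lists≤ k xs
∈-lists≤ {k = zero}  {l = []} _ _ = here refl
∈-lists≤ {k = suc k} {l = []} _ _ = here refl
∈-lists≤ {k = suc k} (s≤s h) (x∈ ∷ l∈) = there (∈-cartesianProductWith⁺ _∷_ x∈ (∈-lists≤ h l∈))

length≤length-concat : ∀ {A : Set} {xs : List A} {xss} → xs ∈ xss → length xs ≤ length (concat xss)
length≤length-concat {xs = xs} {xss} xs∈ with ∈-∃++ xs∈
... | ps , qs , refl = ≤-trans (m≤m+n (length xs) _)
      (≤-reflexive (trans (sym (length-++ xs)) (↭-length (↭-sym (concat-resp-↭ (shift xs ps qs))))))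

module _ (G₁ G₂ : Digraph n) where

  redPairs : List (Pair n)
  redPairs = filterᵇ (λ e → edge G₁ e ∧ not (edge G₂ e)) (pairs n)

  -- In a reduced collection neither the number of walks nor the length of a walk exceeds the number
  -- of red pairs, so a finite list contains all of them.
  candidates : List (List (Walk n))
  candidates = lists≤ (length redPairs) (lists≤ (length redPairs) (pairs n))

  reduced-candidate : ∀ {cs} → Reduced G₁ G₂ cs → cs ∈ candidates
  reduced-candidate {cs} red = ∈-lists≤
    (≤-trans (m≤n+m (length cs) (value cs))
      (≤-reflexive (trans (sym (length-concat cs (nonempty red))) size)))
    (All.tabulate λ w∈cs → ∈-lists≤ (≤-trans (length≤length-concat w∈cs) (≤-reflexive size))
      (All.tabulate λ { {x , y} _ → ∈-cartesianProduct⁺ (∈-allFin x) (∈-allFin y) }))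
    where
    size : length (concat cs) ≡ length redPairs
    size = ↭-length (count⇒↭ (concat cs) redPairs λ e → trans (count-reds red e) (sym (count-pairs _ e)))

  reduced? : ∀ cs → Dec (Reduced G₁ G₂ cs)
  reduced? cs = Dec.map′
    (λ { (r , b , ne) → record
      { count-reds = λ (x , y) → r x y ; count-blues = λ (x , y) → b x y ; nonempty = ne } })
    (λ red → (λ x y → count-reds red (x , y)) , (λ x y → count-blues red (x , y)) , nonempty red)
    (Fin.all? (λ x → Fin.all? λ y → _ Data.Nat.≟ _) ×-dec Fin.all? (λ x → Fin.all? λ y → _ Data.Nat.≟ _)
      ×-dec All.all? (λ w → 1 ≤? length w) cs)

  optimal : ∀ {cs} → Reduced G₁ G₂ cs →
    ∃[ ds ] (Reduced G₁ G₂ ds × (∀ {ws} → Reduced G₁ G₂ ws → value ds ≤ value ws))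
  optimal {cs} red = argmin value cs found , argmin-all value red (All.all-filter reduced? candidates) ,
    λ red′ → All.lookup (f[argmin]≤f[xs] cs found) (∈-filter⁺ reduced? (reduced-candidate red′) red′)
    where found = filter reduced? candidates

-- Construction of swap sequences

-- Read backwards, a cancellation inserts an arc once in each colour; this is how a chord enters
-- when a walk is cut.
⟶-balanced⁻ : ∀ {G₁ G₂ : Digraph n} {cs es ds} → cs ⟶[ es ] ds → Balanced G₁ G₂ ds → Balanced G₁ G₂ cs
⟶-balanced⁻ {G₁ = G₁} {G₂} {cs} {es} {ds} (rewrites r b _) bal e = begin
  count e (concat cs) + ⟦ edge G₂ e ⟧
    ≡⟨ cong (_+ ⟦ edge G₂ e ⟧) (trans (count-resp-↭ e r) (count-++ e es _)) ⟩
  count e es + count e (concat ds) + ⟦ edge G₂ e ⟧      ≡⟨ +-assoc (count e es) _ _ ⟩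
  count e es + (count e (concat ds) + ⟦ edge G₂ e ⟧)    ≡⟨ cong (λ k → count e es + k) (bal e) ⟩
  count e es + (count e (blueArcs ds) + ⟦ edge G₁ e ⟧)  ≡⟨ +-assoc (count e es) _ _ ⟨
  count e es + count e (blueArcs ds) + ⟦ edge G₁ e ⟧
    ≡⟨ cong (_+ ⟦ edge G₁ e ⟧) (trans (count-resp-↭ e b) (count-++ e es _)) ⟨
  count e (blueArcs cs) + ⟦ edge G₁ e ⟧                 ∎
  where open ≡-Reasoning

reduced-balanced : ∀ {G₁ G₂ : Digraph n} {cs} → Reduced G₁ G₂ cs → Balanced G₁ G₂ cs
reduced-balanced {G₁ = G₁} {G₂} red e rewrite count-reds red e | count-blues red e
  with edge G₁ e | edge G₂ e
... | true  | true  = refl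
... | true  | false = refl
... | false | true  = refl
... | false | false = refl

-- A bound instead of an equality leaves room for the value lost in `reduce` and in splittings.
Reachable : Digraph n → Digraph n → ℕ → Set
Reachable G₁ G₂ k = Σ[ ss ∈ SwapSequence G₁ G₂ ] (weight ss ≤ k × OnlyC₄AndTriangular ss)

reachable-mono : ∀ {G₁ G₂ : Digraph n} {j k} → j ≤ k → Reachable G₁ G₂ j → Reachable G₁ G₂ k
reachable-mono j≤k (ss , w , only) = ss , ≤-trans w j≤k , only

exchange-resp-≐ : ∀ {G H G′ : Digraph n} {es ns} → G ≐ H → Exchange H es ns G′ → Exchange G es ns G′
exchange-resp-≐ G≐H ex = record
  { chords      = chords
  ; es-edges    = All.map (λ {e} eq → trans (G≐H e) eq) es-edges
  ; ns-nonEdges = All.map (λ {e} eq → trans (G≐H e) eq) ns-nonEdges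
  ; es-removed  = es-removed
  ; ns-added    = ns-added
  ; elsewhere   = λ e e∉ → trans (elsewhere e e∉) (sym (G≐H e))
  }
  where open Exchange ex

-- A sequence ends at its target only up to pointwise equality, so before concatenation the first
-- swap of the next sequence is transferred to the equal digraph.
reachable-resp-≐ : ∀ {G H K : Digraph n} {k} → G ≐ H → Reachable H K k → Reachable G K k
reachable-resp-≐ G≐H (done H≐K , w , only) = done (λ e → trans (G≐H e) (H≐K e)) , w , only
reachable-resp-≐ G≐H (c₄ s ∷ ss , w , only) =
  c₄ (record { x≢z = x≢z ; y≢t = y≢t ; exchange = exchange-resp-≐ G≐H exchange }) ∷ ss , w , only
  where open C₄Swap s
reachable-resp-≐ G≐H (c₆ s ∷ ss , w , only) =
  c₆ (record { distinctU = distinctU ; distinctW = distinctW ; exchange =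
    exchange-resp-≐ G≐H exchange }) ∷ ss , w , only
  where open C₆Swap s

reachable-trans : ∀ {G M H : Digraph n} {j k} → Reachable G M j → Reachable M H k → Reachable G H (j + k)
reachable-trans {j = j} {k} (ss , w , only) r with append ss only r
  where
  append : ∀ {G M H : Digraph _} {k} (ss : SwapSequence G M) → OnlyC₄AndTriangular ss → Reachable M H k →
    Reachable G H (weight ss + k)
  append (done G≐M) _                r = reachable-resp-≐ G≐M r
  append (s ∷ ss)   (only₁ , only) r with append ss only r
  ... | ts , w′ , only′ = s ∷ ts ,
        ≤-trans (+-monoʳ-≤ (swapWeight s) w′) (≤-reflexive (sym (+-assoc (swapWeight s) _ _))) ,
          only₁ , only′
... | appended = reachable-mono (+-monoˡ-≤ k w) appended

toggle-bit : ∀ r b g → r ≤ ⟦ g ⟧ → b ≤ ⟦ not g ⟧ → ∃[ m ] r + ⟦ m ⟧ ≡ b + ⟦ g ⟧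
toggle-bit zero    zero    true  _         _         = true , refl
toggle-bit (suc _) zero    true  (s≤s z≤n) _         = false , refl
toggle-bit zero    zero    false _         _         = false , refl
toggle-bit zero    (suc _) false _         (s≤s z≤n) = true , refl

-- `M` is `G₁` after the exchange along `cs`. The bounds make this legal: red arcs are present, blue
-- arcs absent, none is used twice, and the chord condition keeps `M` loopless. For `ds` only the
-- signed identity is asserted.
toggle : ∀ {G₁ G₂ : Digraph n} cs {ds} → Balanced G₁ G₂ (cs ++ ds) →
  (∀ e → count e (concat cs) ≤ ⟦ edge G₁ e ⟧) →
  (∀ e → count e (blueArcs cs) ≤ ⟦ not (edge G₁ e) ⟧) →
  All Chord (blueArcs cs) →
  ∃[ M ] (Balanced G₁ M cs × Balanced M G₂ ds)
toggle {G₁ = G₁} {G₂} cs {ds} bal reds≤ blues≤ chords = M , first , second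
  where
  toggled : ∀ e → ∃[ m ] count e (concat cs) + ⟦ m ⟧ ≡ count e (blueArcs cs) + ⟦ edge G₁ e ⟧
  toggled e = toggle-bit (count e (concat cs)) (count e (blueArcs cs)) (edge G₁ e) (reds≤ e) (blues≤ e)
  no-bit : ∀ m → ⟦ m ⟧ ≡ 0 → m ≡ false
  no-bit false _ = refl
  M : Digraph _
  M = record
    { edge     = λ e → proj₁ (toggled e)
    ; loopless = λ x → no-bit _ (m+n≡0⇒n≡0 (count (x , x) (concat cs))
        (trans (proj₂ (toggled (x , x)))
          (cong₂ _+_ (∉⇒count≡0 (blueArcs cs) (λ x∈ → All.lookup chords x∈ refl))
                                                    (cong ⟦_⟧ (loopless G₁ x)))))
    }
  first : Balanced G₁ M cs
  first e = proj₂ (toggled e)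
  second : Balanced M G₂ ds
  second e = +-cancelˡ-≡ (r + b) _ _ (begin
    (r + b) + (r′ + g₂)
      ≡⟨ solve 4 (λ r b s g → (r :+ b) :+ (s :+ g) := b :+ ((r :+ s) :+ g)) refl r b r′ g₂ ⟩
    b + ((r + r′) + g₂)
      ≡⟨ cong (λ k → b + (k + g₂))
      (trans (sym (count-++ e (concat cs) _)) (cong (count e) (concat-++ cs ds))) ⟩
    b + (count e (concat (cs ++ ds)) + g₂)     ≡⟨ cong (λ k → b + k) (bal e) ⟩
    b + (count e (blueArcs (cs ++ ds)) + g₁)
      ≡⟨ cong (λ k → b + (k + g₁))
      (trans (cong (count e) (blueArcs-++ cs ds)) (count-++ e (blueArcs cs) _)) ⟩
    b + ((b + b′) + g₁)
      ≡⟨ solve 3 (λ b c g → b :+ ((b :+ c) :+ g) := (b :+ g) :+ (b :+ c)) refl b b′ g₁ ⟩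
    (b + g₁) + (b + b′)          ≡⟨ cong (_+ (b + b′)) (first e) ⟨
    (r + m) + (b + b′)
      ≡⟨ solve 4 (λ r m b c → (r :+ m) :+ (b :+ c) := (r :+ b) :+ (c :+ m)) refl r m b b′ ⟩
    (r + b) + (b′ + m)           ∎)
    where
    open ≡-Reasoning
    open +-*-Solver using (solve; _:+_; _:=_)
    r  = count e (concat cs)
    r′ = count e (concat ds)
    b  = count e (blueArcs cs)
    b′ = count e (blueArcs ds)
    g₁ = ⟦ edge G₁ e ⟧
    g₂ = ⟦ edge G₂ e ⟧
    m  = ⟦ edge M e ⟧

-- Induction on the value

-- The induction hypothesis ranges over all pairs of digraphs, since a cut introduces a new one, and
-- over all balanced collections, since the parts of a cut need not be reduced.
Solves : ℕ → ℕ → Set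
Solves n k = ∀ {G₁ G₂ : Digraph n} cs → Balanced G₁ G₂ cs → value cs < k → Reachable G₁ G₂ (value cs)

∧-not-≤ˡ : ∀ a b → ⟦ a ∧ not b ⟧ ≤ ⟦ a ⟧
∧-not-≤ˡ true  true  = z≤n
∧-not-≤ˡ true  false = s≤s z≤n
∧-not-≤ˡ false _     = z≤n

∧-not-≤ʳ : ∀ a b → ⟦ a ∧ not b ⟧ ≤ ⟦ not b ⟧
∧-not-≤ʳ true  _     = ≤-refl
∧-not-≤ʳ false _     = z≤n

module _ {G₁ G₂ : Digraph n} where

  -- A walk with one red arc has the same arc as its blue arc. Hence every walk has value at least
  -- 1, so that treating one walk separately leaves two problems of smaller value.
  reduced-long : ∀ {cs w} → Reduced G₁ G₂ cs → w ∈ cs → 2 ≤ length w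
  reduced-long {w = []}        red w∈cs = contradiction (All.lookup (nonempty red) w∈cs) λ ()
  reduced-long {w = e ∷ []}    red w∈cs = contradiction
    (All.lookup (reduced-blues red) (∈-concat⁺′ (here refl) (∈-map⁺ blues w∈cs)))
    (red⇒¬blue {G₁ = G₁} {G₂} (All.lookup (reduced-reds red) (∈-concat⁺′ (here refl) w∈cs)))
  reduced-long {w = _ ∷ _ ∷ _} red w∈cs = s≤s (s≤s z≤n)

  equal-outside : ∀ a b → ⟦ a ∧ not b ⟧ ≡ 0 → ⟦ b ∧ not a ⟧ ≡ 0 → b ≡ a
  equal-outside true  true  _ _ = refl
  equal-outside false false _ _ = refl
  equal-outside true  false () _
  equal-outside false true  _ ()

  reachable-many : ∀ {w w′ cs} → Reduced G₁ G₂ (w ∷ w′ ∷ cs) → Solves n (value (w ∷ w′ ∷ cs)) →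
    Reachable G₁ G₂ (value (w ∷ w′ ∷ cs))
  reachable-many {w} {w′} {cs} red rec with
    toggle {G₁ = G₁} {G₂} (w ∷ []) {w′ ∷ cs} (reduced-balanced red)
      (λ e → ≤-trans (≤-reflexive (cong (count e) (++-identityʳ w)))
        (≤-trans (≤-trans (m≤m+n _ _)
          (≤-reflexive (trans (sym (count-++ e w _)) (count-reds red e)))) (∧-not-≤ˡ (edge G₁ e) _)))
      (λ e → ≤-trans (≤-reflexive (cong (count e) (++-identityʳ (blues w))))
        (≤-trans (≤-trans (m≤m+n _ _)
          (≤-reflexive (trans (sym (count-++ e (blues w) _)) (count-blues red e))))
          (∧-not-≤ʳ (edge G₂ e) _)))
      (All.++⁺ (All.tabulate λ e∈ →
        edge⇒chord G₂ (proj₁ (All.lookup (reduced-blues red) (∈-++⁺ˡ e∈)))) [])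
  ... | M , bal , bal′ =
    reachable-mono (≤-reflexive (cong (_+ value (w′ ∷ cs)) (+-identityʳ (length w ∸ 1))))
        (reachable-trans
          (rec {G₁} {M} (w ∷ []) bal
            (≤-trans (s≤s (≤-reflexive (+-identityʳ _)))
            (≤-trans (≤-reflexive (+-comm 1 _)) (+-monoʳ-≤ (length w ∸ 1) long′))))
          (rec {M} {G₂} (w′ ∷ cs) bal′ (+-monoˡ-≤ (value (w′ ∷ cs)) long)))
    where
    long : 1 ≤ length w ∸ 1
    long = ∸-monoˡ-≤ 1 (reduced-long red (here refl))
    long′ : 1 ≤ value (w′ ∷ cs)
    long′ = ≤-trans (∸-monoˡ-≤ 1 (reduced-long red (there (here refl)))) (m≤m+n _ _)

  module _ {w : Walk n} (red : Reduced G₁ G₂ (w ∷ [])) where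

    single-reds : All (Red G₁ G₂) w
    single-reds = All.tabulate λ e∈ → All.lookup (reduced-reds red) (∈-++⁺ˡ e∈)

    single-blues : All (Blue G₁ G₂) (blues w)
    single-blues = All.tabulate λ e∈ → All.lookup (reduced-blues red) (∈-++⁺ˡ e∈)

    single-count-reds : ∀ e → count e w ≡ ⟦ edge G₁ e ∧ not (edge G₂ e) ⟧
    single-count-reds e = trans (cong (count e) (sym (++-identityʳ w))) (count-reds red e)

    single-count-blues : ∀ e → count e (blues w) ≡ ⟦ edge G₂ e ∧ not (edge G₁ e) ⟧
    single-count-blues e = trans (cong (count e) (sym (++-identityʳ (blues w)))) (count-blues red e)

    -- The order of `ns` is left free because `C₄Swap` lists its non-edges in the opposite order to
    -- `blues`.
    single-exchange : ∀ {ns} → ns ↭ blues w → Exchange G₁ w ns G₂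
    single-exchange {ns} p = record
      { chords      = All.++⁺ (All.map (edge⇒chord G₁ ∘ proj₁) single-reds)
        (All.map (edge⇒chord G₂ ∘ proj₁) ns-blue)
      ; es-edges    = All.map proj₁ single-reds
      ; ns-nonEdges = All.map proj₂ ns-blue
      ; es-removed  = All.map proj₂ single-reds
      ; ns-added    = All.map proj₁ ns-blue
      ; elsewhere   = λ e e∉ → equal-outside (edge G₁ e) (edge G₂ e)
          (trans (sym (single-count-reds e)) (∉⇒count≡0 w (e∉ ∘ ∈-++⁺ˡ)))
          (trans (sym (single-count-blues e)) (∉⇒count≡0 (blues w) (e∉ ∘ ∈-++⁺ʳ w ∘ ∈-resp-↭ (↭-sym p))))
      }
      where
      ns-blue : All (Blue G₁ G₂) ns
      ns-blue = All-resp-↭ (↭-sym p) single-blues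

  reduced-rotated : ∀ {w w′} → Rotated w w′ → Reduced G₁ G₂ (w ∷ []) → Reduced G₁ G₂ (w′ ∷ [])
  reduced-rotated (p , q) red = record
    { count-reds  = λ e → trans (count-resp-↭ e (++⁺ʳ [] (↭-sym p))) (count-reds red e)
    ; count-blues = λ e → trans (count-resp-↭ e (++⁺ʳ [] (↭-sym q))) (count-blues red e)
    ; nonempty    = subst (1 ≤_) (↭-length p) (All.head (nonempty red)) ∷ []
    }

  consecutive-distinct : ∀ {x x′ y y′} → Red G₁ G₂ (x , y) → Blue G₁ G₂ (x′ , y) →
    Red G₁ G₂ (x′ , y′) → x ≢ x′ × y ≢ y′
  consecutive-distinct r b r′ = (λ { refl → red⇒¬blue {G₁ = G₁} {G₂} r b }) ,
    (λ { refl → red⇒¬blue {G₁ = G₁} {G₂} r′ b })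

-- Cutting along a chord

splits-at-first : ∀ {x y v : Fin n} r {s} →
  Splits ((x , y) ∷ r ++ (x , v) ∷ s) ((x , y) ∷ r) ((x , v) ∷ s)
splits-at-first r {s} = splits ↭-refl (↭-reflexive (blues-splitˣ r s)) (s≤s z≤n) (s≤s z≤n)

length-∷ʳ>0 : ∀ {A : Set} (xs : List A) {x} → 1 ≤ length (xs ∷ʳ x)
length-∷ʳ>0 []      = s≤s z≤n
length-∷ʳ>0 (_ ∷ _) = s≤s z≤n

-- If the red chord is the first arc, then `y` is visited there and again at the end of the first
-- part; rotating that arc to the end prepares a split at `y`. Otherwise the chord is a second red
-- arc at `x`.
chord-red-splits : ∀ {x v u y : Fin n} p {q} → 1 ≤ length q →
  (x , y) ∈ ((x , v) ∷ p ∷ʳ (u , y)) ++ q → ∃[ l ] ∃[ r ] Splits (((x , v) ∷ p ∷ʳ (u , y)) ++ q) l r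
chord-red-splits {x = x} {v} {u} {y} p {q} ne (here refl) = p ∷ʳ (u , y) , q ∷ʳ (x , y) , splits
  (↭-trans (proj₁ rot) (↭-reflexive assoc))
  (↭-trans (proj₂ rot) (↭-trans (↭-reflexive (cong blues assoc)) (blues-splitʸ p q)))
  (length-∷ʳ>0 p) (length-∷ʳ>0 q)
  where
  rot = rotate ((x , y) ∷ []) ((p ∷ʳ (u , y)) ++ q)
  assoc = ++-assoc (p ∷ʳ (u , y)) q ((x , y) ∷ [])
chord-red-splits p ne (there c∈) with ∈-∃++ c∈
... | r , s , eq rewrite eq = _ , _ , splits-at-first r

-- A blue chord that does not close the walk is followed by another red arc at `x`. One that closes
-- it forces the last arc of `q` to end in `y`, as the first part does.
chord-blue-splits : ∀ {x v u y : Fin n} p {q} → 1 ≤ length q →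
  (x , y) ∈ blues (((x , v) ∷ p ∷ʳ (u , y)) ++ q) →
    ∃[ l ] ∃[ r ] Splits (((x , v) ∷ p ∷ʳ (u , y)) ++ q) l r
chord-blue-splits {x = x} {v} {u} {y} p {q} ne c∈ with ∈-bluesTo⁻ (((x , v) ∷ p ∷ʳ (u , y)) ++ q) c∈
... | inj₁ ([] , u′ , v′ , s , eq) with refl , eq′ ← ∷-injective eq rewrite eq′ =
  _ , _ , splits-at-first []
... | inj₁ (a ∷ r , u′ , v′ , s , eq) with refl , eq′ ← ∷-injective eq
    rewrite trans eq′ (sym (++-assoc r ((u′ , y) ∷ []) ((x , v′) ∷ s))) =
  _ , _ , splits-at-first (r ∷ʳ (u′ , y))
... | inj₂ (r , u′ , eq , _) with initLast q
chord-blue-splits p {.[]} () c∈ | inj₂ (r , u′ , eq , _) | []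
chord-blue-splits {x = x} {v} {u} {y} p ne c∈ | inj₂ (r , u′ , eq , _) | q ∷ʳ′ b
  with refl ← ∷ʳ-injectiveʳ (((x , v) ∷ p ∷ʳ (u , y)) ++ q) r
    (trans (++-assoc ((x , v) ∷ p ∷ʳ (u , y)) q (b ∷ [])) eq) =
  (x , v) ∷ p ∷ʳ (u , y) , q ∷ʳ b , splits ↭-refl (blues-splitʸ ((x , v) ∷ p) q) (s≤s z≤n) ne

module _ {x v u y : Fin n} (p q : Walk n) where

  private
    P w : Walk n
    P = (x , v) ∷ p ∷ʳ (u , y)
    w = P ++ q
    c : Pair n
    c = x , y

  value-chord : value (w ∷ []) ≡ value (P ∷ []) + value ((c ∷ q) ∷ [])
  value-chord = trans (cong (_+ 0) (length-++ (p ∷ʳ (u , y))))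
    (trans (+-assoc (length (p ∷ʳ (u , y))) (length q) 0)
           (cong (_+ (length q + 0)) (sym (+-identityʳ (length (p ∷ʳ (u , y)))))))

  chord-⟶ : P ∷ (c ∷ q) ∷ [] ⟶[ c ∷ [] ] w ∷ []
  chord-⟶ = rewrites
    (↭-trans (↭-reflexive (sym (++-assoc P (c ∷ q) []))) (++⁺ʳ [] (shift c P q)))
    (↭-trans (↭-reflexive (sym (++-assoc (blues P) (blues (c ∷ q)) [])))
      (++⁺ʳ [] (blues-chord ((x , v) ∷ p) q)))
    (≤-reflexive (trans value-chord
      (cong (_+ value ((c ∷ q) ∷ [])) (+-identityʳ (length (p ∷ʳ (u , y)))))))

  count-chord-blues : ∀ e → count e (blues P) + count e (blues (c ∷ q)) ≡ count e (c ∷ blues w)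
  count-chord-blues e =
    trans (sym (count-++ e (blues P) _)) (count-resp-↭ e (blues-chord ((x , v) ∷ p) q))

  blues-P : blues P ↭ c ∷ bluesTo ((x , v) ∷ p) u
  blues-P = ↭-trans (↭-reflexive (blues-∷ʳ ((x , v) ∷ p) u y)) (↭-sym (∷↭∷ʳ c _))

  -- The added blue copy of `c` closes `P`, so the other walk has only blue arcs of `w`.
  count-rest-blues : ∀ e → count e (blues (c ∷ q)) ≤ count e (blues w)
  count-rest-blues e = +-cancelˡ-≤ ⟦ does (e ≟ₚ c) ⟧ _ _ (begin
    ⟦ does (e ≟ₚ c) ⟧ + count e (blues (c ∷ q))
      ≤⟨ +-monoˡ-≤ _ (m≤m+n ⟦ does (e ≟ₚ c) ⟧ (count e B)) ⟩
    (⟦ does (e ≟ₚ c) ⟧ + count e B) + count e (blues (c ∷ q))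
      ≡⟨ cong (_+ count e (blues (c ∷ q))) (count-resp-↭ e blues-P) ⟨
    count e (blues P) + count e (blues (c ∷ q))                          ≡⟨ count-chord-blues e ⟩
    ⟦ does (e ≟ₚ c) ⟧ + count e (blues w)                                ∎)
    where
    open ≤-Reasoning
    B = bluesTo ((x , v) ∷ p) u

  module _ {G₁ G₂ : Digraph n} (red : Reduced G₁ G₂ (w ∷ [])) (x≢y : x ≢ y) (ne : 1 ≤ length q)
           (rec : Solves n (value (w ∷ []))) where

    private
      balanced : Balanced G₁ G₂ (P ∷ (c ∷ q) ∷ [])
      balanced = ⟶-balanced⁻ {G₁ = G₁} {G₂} chord-⟶ (reduced-balanced red)

      value-P< : value (P ∷ []) < value (w ∷ [])
      value-P< = ≤-trans (≤-trans (≤-reflexive (+-comm 1 (value (P ∷ []))))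
        (+-monoʳ-≤ (value (P ∷ [])) (≤-trans ne (≤-reflexive (sym (+-identityʳ (length q)))))))
        (≤-reflexive (sym value-chord))

      value-rest< : value ((c ∷ q) ∷ []) < value (w ∷ [])
      value-rest< = ≤-trans
        (+-monoˡ-≤ (value ((c ∷ q) ∷ [])) (≤-trans (length-∷ʳ>0 p) (≤-reflexive (sym (+-identityʳ _)))))
        (≤-reflexive (sym value-chord))

      extra : ∀ {b xs} (f : Pair n → Bool) → count c xs ≡ 0 → f c ≡ b → 1 ≤ ⟦ b ⟧ →
        (∀ e → count e xs ≤ ⟦ f e ⟧) → ∀ e → count e (c ∷ xs) ≤ ⟦ f e ⟧
      extra f none refl 1≤fc bound e with e ≟ₚ c
      ... | yes refl = subst (λ k → suc k ≤ ⟦ f c ⟧) (sym none) 1≤fc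
      ... | no _     = bound e

      reds≤ : ∀ e → count e w ≤ ⟦ edge G₁ e ⟧
      reds≤ e = ≤-trans (≤-reflexive (single-count-reds red e)) (∧-not-≤ˡ (edge G₁ e) _)

      blues≤ : ∀ e → count e (blues w) ≤ ⟦ not (edge G₁ e) ⟧
      blues≤ e = ≤-trans (≤-reflexive (single-count-blues red e)) (∧-not-≤ʳ (edge G₂ e) _)

      no-red : edge G₁ c ≡ edge G₂ c → count c w ≡ 0
      no-red eq = trans (single-count-reds red c)
        (cong ⟦_⟧ (trans (cong (λ b → edge G₁ c ∧ not b) (sym eq)) (∧-inverseʳ (edge G₁ c))))

      no-blue : edge G₁ c ≡ edge G₂ c → count c (blues w) ≡ 0
      no-blue eq = trans (single-count-blues red c)
        (cong ⟦_⟧ (trans (cong (λ b → edge G₂ c ∧ not b) eq) (∧-inverseʳ (edge G₂ c))))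

      chords : All Chord (c ∷ blues w)
      chords = x≢y ∷ All.map (λ blue → edge⇒chord G₂ (proj₁ blue)) (single-blues red)

    -- `P` has `c` as a blue arc and so inserts it; the other walk has it as a red arc and deletes
    -- it again. With `c` absent from both digraphs, `P` must go first.
    cut-first : edge G₁ c ≡ false → edge G₂ c ≡ false → Reachable G₁ G₂ (value (w ∷ []))
    cut-first g₁ g₂ = meet
      (toggle {G₁ = G₁} {G₂} (P ∷ []) {(c ∷ q) ∷ []} balanced reds-P blues-P≤ chords-P)
      where
      reds-P : ∀ e → count e (concat (P ∷ [])) ≤ ⟦ edge G₁ e ⟧
      reds-P e = ≤-trans (≤-reflexive (cong (count e) (++-identityʳ P)))
        (≤-trans (≤-trans (m≤m+n (count e P) (count e q)) (≤-reflexive (sym (count-++ e P q))))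
          (reds≤ e))
      part-P : ∀ e → count e (blueArcs (P ∷ [])) ≤ count e (c ∷ blues w)
      part-P e = ≤-trans (≤-reflexive (cong (count e) (++-identityʳ (blues P))))
        (≤-trans (m≤m+n (count e (blues P)) (count e (blues (c ∷ q))))
          (≤-reflexive (count-chord-blues e)))
      blues-P≤ : ∀ e → count e (blueArcs (P ∷ [])) ≤ ⟦ not (edge G₁ e) ⟧
      blues-P≤ e = ≤-trans (part-P e)
        (extra {true} {blues w} (not ∘ edge G₁) (no-blue (trans g₁ (sym g₂))) (cong not g₁) ≤-refl
          blues≤ e)
      chords-P : All Chord (blueArcs (P ∷ []))
      chords-P = All.tabulate λ {e} e∈ →
        All.lookup chords (count>0⇒∈ (c ∷ blues w) (≤-trans (∈⇒count>0 e∈) (part-P e)))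
      meet : ∃[ M ] (Balanced G₁ M (P ∷ []) × Balanced M G₂ ((c ∷ q) ∷ [])) →
        Reachable G₁ G₂ (value (w ∷ []))
      meet (M , bal , bal′) = subst (Reachable G₁ G₂) (sym value-chord)
          (reachable-trans (rec {G₁} {M} (P ∷ []) bal value-P<)
            (rec {M} {G₂} ((c ∷ q) ∷ []) bal′ value-rest<))

    -- With `c` present in both digraphs the order is reversed: the walk `c ∷ q` deletes it and `P`
    -- restores it.
    cut-last : edge G₁ c ≡ true → edge G₂ c ≡ true → Reachable G₁ G₂ (value (w ∷ []))
    cut-last g₁ g₂ = meet
      (toggle {G₁ = G₁} {G₂} ((c ∷ q) ∷ []) {P ∷ []} balanced′ reds-rest blues-rest chords-rest)
      where
      swapped : (c ∷ q) ∷ P ∷ [] ↭ P ∷ (c ∷ q) ∷ []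
      swapped = Perm.swap (c ∷ q) P ↭-refl
      balanced′ : Balanced G₁ G₂ ((c ∷ q) ∷ P ∷ [])
      balanced′ e = trans (cong (_+ ⟦ edge G₂ e ⟧) (count-resp-↭ e (concat-resp-↭ swapped)))
        (trans (balanced e) (cong (_+ ⟦ edge G₁ e ⟧)
          (count-resp-↭ e (concat-resp-↭ (map⁺ blues (↭-sym swapped))))))
      reds-rest : ∀ e → count e (concat ((c ∷ q) ∷ [])) ≤ ⟦ edge G₁ e ⟧
      reds-rest e = ≤-trans (≤-reflexive (cong (count e) (++-identityʳ (c ∷ q))))
        (≤-trans (+-monoʳ-≤ ⟦ does (e ≟ₚ c) ⟧
          (≤-trans (m≤n+m (count e q) (count e P)) (≤-reflexive (sym (count-++ e P q)))))
          (extra {true} {w} (edge G₁) (no-red (trans g₁ (sym g₂))) g₁ ≤-refl reds≤ e))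
      part-rest : ∀ e → count e (blueArcs ((c ∷ q) ∷ [])) ≤ count e (blues w)
      part-rest e = ≤-trans (≤-reflexive (cong (count e) (++-identityʳ (blues (c ∷ q)))))
        (count-rest-blues e)
      blues-rest : ∀ e → count e (blueArcs ((c ∷ q) ∷ [])) ≤ ⟦ not (edge G₁ e) ⟧
      blues-rest e = ≤-trans (part-rest e) (blues≤ e)
      chords-rest : All Chord (blueArcs ((c ∷ q) ∷ []))
      chords-rest = All.tabulate λ {e} e∈ →
        All.lookup chords (there (count>0⇒∈ (blues w) (≤-trans (∈⇒count>0 e∈) (part-rest e))))
      meet : ∃[ M ] (Balanced G₁ M ((c ∷ q) ∷ []) × Balanced M G₂ (P ∷ [])) →
        Reachable G₁ G₂ (value (w ∷ []))
      meet (M , bal , bal′) =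
        subst (Reachable G₁ G₂)
        (trans (+-comm (value ((c ∷ q) ∷ [])) (value (P ∷ []))) (sym value-chord))
          (reachable-trans (rec {G₁} {M} ((c ∷ q) ∷ []) bal value-rest<)
            (rec {M} {G₂} (P ∷ []) bal′ value-P<))

    -- Splitting gains a walk and lowers the value, so the induction hypothesis applies to both
    -- parts at once, without an intermediate digraph.
    reachable-splits : ∃[ l ] ∃[ r ] Splits w l r → Reachable G₁ G₂ (value (w ∷ []))
    reachable-splits (l , r , s) = reachable-mono (<⇒≤ (value-split s))
      (rec {G₁} {G₂} (l ∷ r ∷ []) (⟶-balanced {G₁ = G₁} {G₂} (split-⟶ s) (reduced-balanced red))
        (value-split s))

    -- If the chord is itself an arc of the walk, the walk repeats a vertex.
    reachable-chord : Reachable G₁ G₂ (value (w ∷ []))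
    reachable-chord with edge G₁ c in g₁ | edge G₂ c in g₂
    ... | false | false = cut-first g₁ g₂
    ... | true  | true  = cut-last g₁ g₂
    ... | true  | false = reachable-splits (chord-red-splits p ne (count>0⇒∈ w
          (≤-reflexive (sym (trans (single-count-reds red c) (cong₂ (λ a b → ⟦ a ∧ not b ⟧) g₁ g₂))))))
    ... | false | true  = reachable-splits (chord-blue-splits p ne (count>0⇒∈ (blues w)
          (≤-reflexive (sym (trans (single-count-blues red c) (cong₂ (λ a b → ⟦ b ∧ not a ⟧) g₁ g₂))))))

-- Single walks by length, and completion of the induction

module _ {G₁ G₂ : Digraph n} where

  reachable-two : ∀ {a b} → Reduced G₁ G₂ ((a ∷ b ∷ []) ∷ []) → Reachable G₁ G₂ 1
  reachable-two {a} {b} red with single-reds red | single-blues red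
  ... | r₁ ∷ r₂ ∷ [] | b₁ ∷ _ with consecutive-distinct {G₁ = G₁} {G₂} r₁ b₁ r₂
  ...   | x≢z , y≢t = c₄ (record { x≢z = x≢z ; y≢t = y≢t
            ; exchange = single-exchange red (Perm.swap _ _ ↭-refl) }) ∷ done (λ _ → refl)
          , ≤-refl , _

  -- If one of the three opposite pairs is a chord, a rotation brings it into the position of the
  -- cut, which leaves two walks of value 1. If none is, the hexagon is triangular.
  reachable-three : ∀ {a b c} → Reduced G₁ G₂ ((a ∷ b ∷ c ∷ []) ∷ []) → Solves n 2 → Reachable G₁ G₂ 2
  reachable-three {x₁ , y₁} {x₂ , y₂} {x₃ , y₃} red rec
    with x₁ Fin.≟ y₂ | x₂ Fin.≟ y₃ | x₃ Fin.≟ y₁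
  ... | no x₁≢y₂ | _        | _        = reachable-chord [] ((x₃ , y₃) ∷ []) red x₁≢y₂ (s≤s z≤n) rec
  ... | yes _    | no x₂≢y₃ | _        = reachable-chord [] ((x₁ , y₁) ∷ [])
        (reduced-rotated (rotate ((x₁ , y₁) ∷ []) ((x₂ , y₂) ∷ (x₃ , y₃) ∷ [])) red) x₂≢y₃ (s≤s z≤n) rec
  ... | yes _    | yes _    | no x₃≢y₁ = reachable-chord [] ((x₂ , y₂) ∷ [])
        (reduced-rotated (rotate ((x₁ , y₁) ∷ (x₂ , y₂) ∷ []) ((x₃ , y₃) ∷ [])) red) x₃≢y₁ (s≤s z≤n) rec
  ... | yes p    | yes q    | yes r    with single-reds red | single-blues red
  ...   | r₁ ∷ r₂ ∷ r₃ ∷ [] | b₁ ∷ b₂ ∷ b₃ ∷ []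
          with consecutive-distinct {G₁ = G₁} {G₂} r₁ b₁ r₂
             | consecutive-distinct {G₁ = G₁} {G₂} r₂ b₂ r₃
             | consecutive-distinct {G₁ = G₁} {G₂} r₃ b₃ r₁
  ...     | x₁≢x₂ , y₁≢y₂ | x₂≢x₃ , y₂≢y₃ | x₃≢x₁ , y₃≢y₁ =
            c₆ (record { distinctU = x₁≢x₂ , x₂≢x₃ , x₃≢x₁ ; distinctW = y₁≢y₂ , y₂≢y₃ , y₃≢y₁
              ; exchange = single-exchange red ↭-refl }) ∷ done (λ _ → refl)
            , ≤-refl , (p , q , r) , _

  -- Of the pairs joining the first vertex to w_y₂ and w_y₃, at most one is a non-chord.
  reachable-long : ∀ {a b c d w} → Reduced G₁ G₂ ((a ∷ b ∷ c ∷ d ∷ w) ∷ []) →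
    Solves n (value ((a ∷ b ∷ c ∷ d ∷ w) ∷ [])) → Reachable G₁ G₂ (value ((a ∷ b ∷ c ∷ d ∷ w) ∷ []))
  reachable-long {a@(x₁ , y₁)} {b@(x₂ , y₂)} {c@(x₃ , y₃)} {d} {w} red rec with x₁ Fin.≟ y₂
  ... | no x₁≢y₂ = reachable-chord [] (c ∷ d ∷ w) red x₁≢y₂ (s≤s z≤n) rec
  ... | yes refl with single-reds red | single-blues red
  ...   | _ ∷ r₂ ∷ r₃ ∷ _ | _ ∷ b₂ ∷ _ =
          reachable-chord (b ∷ []) (d ∷ w) red
            (proj₂ (consecutive-distinct {G₁ = G₁} {G₂} r₂ b₂ r₃)) (s≤s z≤n) rec

  reachable-reduced : ∀ {cs} → Reduced G₁ G₂ cs → Solves n (value cs) → Reachable G₁ G₂ (value cs)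
  reachable-reduced {[]} red rec = done (λ e → sym (equal-outside {G₁ = G₁} {G₂} (edge G₁ e) (edge G₂ e)
    (sym (count-reds red e)) (sym (count-blues red e)))) , z≤n , _
  reachable-reduced {_ ∷ _ ∷ _}                 red rec = reachable-many red rec
  reachable-reduced {[] ∷ []}                   red rec =
    contradiction (reduced-long red (here refl)) λ ()
  reachable-reduced {(_ ∷ []) ∷ []}             red rec =
    contradiction (reduced-long red (here refl)) λ { (s≤s ()) }
  reachable-reduced {(_ ∷ _ ∷ []) ∷ []}         red rec = reachable-two red
  reachable-reduced {(_ ∷ _ ∷ _ ∷ []) ∷ []}     red rec = reachable-three red rec
  reachable-reduced {(_ ∷ _ ∷ _ ∷ _ ∷ _) ∷ []} red rec = reachable-long red rec

-- Reducing first makes the case distinction on circuits available; as it does not raise the value,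
-- the recursive calls stay below the bound.
solve-all : ∀ k → Solves n k
solve-all (suc k) {G₁} {G₂} cs bal (s≤s h) with reduce {G₁ = G₁} {G₂} {cs} bal
... | ds , red , ds≤cs = reachable-mono ds≤cs (reachable-reduced red
      λ {H₁} {H₂} ws bal′ ws<ds → solve-all k {H₁} {H₂} ws bal′ (≤-trans ws<ds (≤-trans ds≤cs h)))

-- The minimum and the distance formula

open import Data.Integer using (+_; _⊖_)

module _ {G₁ G₂ : Digraph n} {cs} (red : Reduced G₁ G₂ cs)
         (least : ∀ {ws} → Reduced G₁ G₂ ws → value cs ≤ value ws) where

  weight-least : (ss : SwapSequence G₁ G₂) → value cs ≤ weight ss
  weight-least ss with swaps-balanced ss
  ... | ws , bal , eq with reduce {G₁ = G₁} {G₂} {ws} bal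
  ...   | ws′ , red′ , le = ≤-trans (least red′) (≤-trans le (≤-reflexive eq))

  decomposition-greatest : ∀ ds → IsDecomposition G₁ G₂ ds → length ds ≤ length cs
  decomposition-greatest ds dec with decomposition-reduced dec
  ... | ws , red′ , eq = subst (_≤ length cs) eq (+-cancelˡ-≤ (value cs) _ _ (begin
    value cs + length ws  ≤⟨ +-monoˡ-≤ (length ws) (least red′) ⟩
    value ws + length ws  ≡⟨ H′-reduced red′ ⟨
    H′ G₁ G₂              ≡⟨ H′-reduced red ⟩
    value cs + length cs  ∎))
    where open ≤-Reasoning

  optimal-distance : ∃[ dist′ ] ∃[ maxC ]
    ( IsDist′ G₁ G₂ dist′
    × IsMaxC G₁ G₂ maxC
    × + dist′ ≡ H′ G₁ G₂ ⊖ maxC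
    × (Σ[ ss ∈ SwapSequence G₁ G₂ ] (weight ss ≡ dist′ × OnlyC₄AndTriangular ss)) )
  optimal-distance = from-shortest
    (solve-all (suc (value cs)) {G₁} {G₂} cs (reduced-balanced red) ≤-refl)
    where
    distance : + value cs ≡ H′ G₁ G₂ ⊖ length cs
    distance = trans (cong +_ (sym (m+n∸n≡m (value cs) (length cs))))
      (trans (sym (ℤ.⊖-≥ (m≤n+m (length cs) (value cs)))) (cong (_⊖ length cs) (sym (H′-reduced red))))
    from-shortest : Reachable G₁ G₂ (value cs) → _
    from-shortest (ss , ss≤ , only) = value cs , length cs ,
      ((ss , weight-ss) , λ { j (ts , refl) → weight-least ts }) ,
      ((map circuit cs , reduced-decomposition G₁ G₂ red , length-map circuit cs) ,
        λ { k (ds , dec , refl) → decomposition-greatest ds dec }) ,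
      distance , ss , weight-ss , only
      where
      weight-ss : weight ss ≡ value cs
      -- The construction gives only an upper bound; as no sequence is lighter than the least value,
      -- it is attained.
      weight-ss = ≤-antisym ss≤ (weight-least ss)

theorem5p5 : ∀ (n : ℕ) (d⁺ d⁻ : Fin n → ℕ) (G₁ G₂ : Digraph n) →
    Realizes G₁ d⁺ d⁻ → Realizes G₂ d⁺ d⁻ →
    ∃[ dist′ ] ∃[ maxC ]
    ( IsDist′ G₁ G₂ dist′
    × IsMaxC G₁ G₂ maxC
    × + dist′ ≡ H′ G₁ G₂ ⊖ maxC
    × (Σ[ ss ∈ SwapSequence G₁ G₂ ] (weight ss ≡ dist′ × OnlyC₄AndTriangular ss)) )
theorem5p5 n d⁺ d⁻ G₁ G₂ r₁ r₂ =
  let (cs , bal)         = realizations-balanced {G₁ = G₁} {G₂} r₁ r₂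
      (_ , red , _)      = reduce {G₁ = G₁} {G₂} {cs} bal
      (_ , red′ , least) = optimal G₁ G₂ red
  in optimal-distance red′ least
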